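{- Let $G_1=(V,D_1)$ and $G_2=(V,D_2)$ be two simple directed graphs on the same node set $V$. If at least one of $G_1,G_2$ is not complete and there exists a node $i\in V$ such that $|\mathrm{ch}_1(i)|\neq|\mathrm{ch}_2(i)|$, then $G_1$ and $G_2$ have different Jacobian matroids.
   Context: A directed graph $G=(V,D)$ has a finite node set $V$ and edge set $D\subseteq V\times V$ of ordered pairs $(i,j)$, $i\neq j$, written $i\to j$. It is simple if $(i,j)$ and $(j,i)$ are never both in $D$. It is complete if every pair of distinct nodes is adjacent, i.e. joined by an edge in some direction. $\mathrm{ch}_k(i)=\{j:(i,j)\in D_k\}$ is the set of children of $i$ in $G_k$. For $G=(V,D)$ let $\Lambda=(\lambda_{ij})$ be the $V\times V$ matrix with indeterminate entries $\lambda_{ij}$ for $(i,j)\in D$ and zeros elsewhere, and let $s$ be a further indeterminate. The precision parameterization is $\psi_G(\Lambda,s)=s(I-\Lambda)(I-\Lambda)^T=K=(K_{ij})$. The (transposed) Jacobian $J=J(\psi_G)$ has one row for each parameter $\lambda_{kl}$, $(k,l)\in D$, and one row for $s$. It has one column for each entry $K_{ij}$ with $i\le j$ (equivalently, for each unordered pair $\{i,j\}$, including $i=j$). The entry in row $\theta$, column $K_{ij}$ is $\partial K_{ij}/\partial\theta$. The Jacobian matroid of $G$ is the matroid on this set of columns in which a set of columns is independent iff the columns are linearly independent over the field $\mathbb{R}(\lambda,s)$ of rational functions in the parameters. -}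

module Defs where

open import Algebra.Bundles using (CommutativeRing; RawRing)
import Algebra.Definitions.RawMonoid as RawMonoidDefs
open import Algebra.Structures using (IsCommutativeRing)
open import Data.Bool.Base using (Bool; T; if_then_else_)
open import Data.Bool.Properties using (T-irrelevant)
open import Data.Fin.Base as Fin using (Fin)
import Data.Fin.Properties as Fin
open import Data.Fin.Subset using (Subset)
open import Data.List.Base using (List; length; lookup)
open import Data.List.Relation.Unary.Unique.Propositional using (Unique)
open import Data.Nat.Base as ℕ using (ℕ)
import Data.Nat.Properties as ℕ
open import Data.Product using (∃; _×_; _,_)
open import Data.Rational.Base as ℚ using (ℚ; 0ℚ; 1ℚ; ½)
import Data.Rational.Properties as ℚ
open import Data.Sum.Base using (_⊎_)
open import Data.Vec.Base using (tabulate)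
open import Function.Bundles using (_⇔_)
open import Level using (0ℓ; _⊔_)
open import Relation.Binary.Definitions using (DecidableEquality)
open import Relation.Binary.PropositionalEquality
  using (_≡_; _≢_; refl; sym; trans; cong; subst)
open import Relation.Binary.Structures using (IsEquivalence)
open import Relation.Nullary using (¬_; yes; no; does)
open import Relation.Nullary.Decidable using (T?; dec⇒maybe)
open import Tactic.RingSolver using (solve-∀)
open import Tactic.RingSolver.Core.AlmostCommutativeRing
  using (AlmostCommutativeRing; fromCommutativeRing)

------------------------------------------------------------------------
-- The real numbers: Cauchy sequences of rationals, two sequences being
-- equal when their difference tends to 0.

Cauchy : (ℕ → ℚ) → Set
Cauchy x = ∀ ε → 0ℚ ℚ.< ε →
  ∃ λ N → ∀ m n → N ℕ.≤ m → N ℕ.≤ n → ℚ.∣ x m ℚ.- x n ∣ ℚ.< ε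

record ℝ : Set where
  constructor real
  field
    seq    : ℕ → ℚ
    cauchy : Cauchy seq

open ℝ public

infix 4 _≃_

_≃_ : ℝ → ℝ → Set
x ≃ y = ∀ ε → 0ℚ ℚ.< ε →
  ∃ λ N → ∀ n → N ℕ.≤ n → ℚ.∣ seq x n ℚ.- seq y n ∣ ℚ.< ε

private
  ℚ-ring : AlmostCommutativeRing 0ℓ 0ℓ
  ℚ-ring = fromCommutativeRing ℚ.+-*-commutativeRing λ q → dec⇒maybe (0ℚ ℚ.≟ q)

  module Estimates where
    open import Data.Rational.Base using (_+_; _*_; _-_; -_; ∣_∣; _<_)

    opaque
      half : ℚ → ℚ
      half ε = ½ * ε

      half-pos : ∀ {ε} → 0ℚ < ε → 0ℚ < half ε
      half-pos {ε} 0<ε =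
        subst (_< ½ * ε) (ℚ.*-zeroʳ ½) (ℚ.*-monoʳ-<-pos ½ 0<ε)

      half+half : ∀ ε → half ε + half ε ≡ ε
      half+half ε = trans (sym (ℚ.*-distribʳ-+ ε ½ ½)) (ℚ.*-identityˡ ε)

    triangle : ∀ a b {p q r} → a + b ≡ p → ∣ a ∣ < q → ∣ b ∣ < r → ∣ p ∣ < q + r
    triangle a b refl a<q b<r =
      ℚ.≤-<-trans (ℚ.∣p+q∣≤∣p∣+∣q∣ a b) (ℚ.+-mono-< a<q b<r)

    triangle½ : ∀ a b {p ε} → a + b ≡ p → ∣ a ∣ < half ε → ∣ b ∣ < half ε → ∣ p ∣ < ε
    triangle½ a b {p} {ε} eq a< b< =
      subst (∣ p ∣ <_) (half+half ε) (triangle a b eq a< b<)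

    cancel-self : ∀ a {ε} → 0ℚ < ε → ∣ a - a ∣ < ε
    cancel-self a {ε} 0<ε = subst (λ z → ∣ z ∣ < ε) (sym (ℚ.+-inverseʳ a)) 0<ε

    swap : ∀ a b {ε} → ∣ a - b ∣ < ε → ∣ b - a ∣ < ε
    swap a b {ε} = subst (_< ε)
      (trans (sym (ℚ.∣-p∣≡∣p∣ (a - b))) (cong ∣_∣ (eq a b)))
      where
      eq : ∀ a b → - (a - b) ≡ b - a
      eq = solve-∀ ℚ-ring

    opaque
      -- δ / A, for a positive bound A
      quot : ∀ {A} → 0ℚ < A → ℚ → ℚ
      quot {A} 0<A δ = (ℚ.1/ A) {{ℚ.>-nonZero 0<A}} * δ

      quot-pos : ∀ {A} (0<A : 0ℚ < A) {δ} → 0ℚ < δ → 0ℚ < quot 0<A δ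
      quot-pos {A} 0<A {δ} 0<δ =
        subst (_< quot 0<A δ) (ℚ.*-zeroʳ 1/A) (ℚ.*-monoʳ-<-pos 1/A {{pos}} 0<δ)
        where
        1/A : ℚ
        1/A = (ℚ.1/ A) {{ℚ.>-nonZero 0<A}}
        pos : ℚ.Positive 1/A
        pos = ℚ.1/pos⇒pos A {{ℚ.positive 0<A}}

      quot-cancel : ∀ {A} (0<A : 0ℚ < A) δ → A * quot 0<A δ ≡ δ
      quot-cancel {A} 0<A δ = trans (sym (ℚ.*-assoc A _ δ))
        (trans (cong (_* δ) (ℚ.*-inverseʳ A {{ℚ.>-nonZero 0<A}})) (ℚ.*-identityˡ δ))

    product-small : ∀ {A} (0<A : 0ℚ < A) a b {δ} →
                    ∣ a ∣ < A → ∣ b ∣ < quot 0<A δ → ∣ a * b ∣ < δ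
    product-small {A} 0<A a b {δ} a<A b<δ/A = begin-strict
      ∣ a * b ∣      ≡⟨ ℚ.∣p*q∣≡∣p∣*∣q∣ a b ⟩
      ∣ a ∣ * ∣ b ∣  ≤⟨ ℚ.*-monoʳ-≤-nonNeg ∣ b ∣ {{ℚ.∣-∣-nonNeg b}} (ℚ.<⇒≤ a<A) ⟩
      A * ∣ b ∣      <⟨ ℚ.*-monoʳ-<-pos A {{ℚ.positive 0<A}} b<δ/A ⟩
      A * quot 0<A δ ≡⟨ quot-cancel 0<A δ ⟩
      δ              ∎
      where open ℚ.≤-Reasoning

    products-close : ∀ {A D} (0<A : 0ℚ < A) (0<D : 0ℚ < D) a b c d {ε} →
                     ∣ a ∣ < A → ∣ d ∣ < D →
                     ∣ b - d ∣ < quot 0<A (half ε) → ∣ a - c ∣ < quot 0<D (half ε) →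
                     ∣ a * b - c * d ∣ < ε
    products-close 0<A 0<D a b c d a<A d<D bd ac =
      triangle½ (a * (b - d)) (d * (a - c)) (eq a b c d)
        (product-small 0<A a (b - d) a<A bd) (product-small 0<D d (a - c) d<D ac)
      where
      eq : ∀ a b c d → a * (b - d) + d * (a - c) ≡ a * b - c * d
      eq = solve-∀ ℚ-ring

    eventually-bounded : ∀ x → Cauchy x →
      ∃ λ A → 0ℚ < A × ∃ λ N → ∀ n → N ℕ.≤ n → ∣ x n ∣ < A
    eventually-bounded x cx with cx 1ℚ (ℚ.positive⁻¹ 1ℚ)
    ... | N , close = 1ℚ + ∣ x N ∣ ,
      ℚ.+-mono-<-≤ (ℚ.positive⁻¹ 1ℚ) (ℚ.0≤∣p∣ (x N)) , N ,
      λ n N≤n → ℚ.≤-<-trans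
        (subst (λ z → ∣ z ∣ ℚ.≤ ∣ x n - x N ∣ + ∣ x N ∣) (eq (x n) (x N))
          (ℚ.∣p+q∣≤∣p∣+∣q∣ (x n - x N) (x N)))
        (ℚ.+-monoˡ-< ∣ x N ∣ (close n N N≤n ℕ.≤-refl))
      where
      eq : ∀ a b → (a - b) + b ≡ a
      eq = solve-∀ ℚ-ring

    ⊔₁ : ∀ {k l m} → k ℕ.⊔ l ℕ.≤ m → k ℕ.≤ m
    ⊔₁ {k} {l} = ℕ.≤-trans (ℕ.m≤m⊔n k l)

    ⊔₂ : ∀ {k l m} → k ℕ.⊔ l ℕ.≤ m → l ℕ.≤ m
    ⊔₂ {k} {l} = ℕ.≤-trans (ℕ.m≤n⊔m k l)

    +-regroup : ∀ a b c d → (a - c) + (b - d) ≡ (a + b) - (c + d)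
    +-regroup = solve-∀ ℚ-ring

    neg-regroup : ∀ a b → b - a ≡ - a - - b
    neg-regroup = solve-∀ ℚ-ring

    pointwise : ∀ {x y : ℝ} → (∀ n → seq x n ≡ seq y n) → x ≃ y
    pointwise {x} x≡y ε 0<ε = 0 , λ n _ →
      subst (λ z → ∣ seq x n - z ∣ < ε) (x≡y n) (cancel-self (seq x n) 0<ε)

  open Estimates

infixl 6 _+ᴿ_
infixl 7 _*ᴿ_
infix  8 -ᴿ_

constᴿ : ℚ → ℝ
constᴿ q = real (λ _ → q) λ ε 0<ε → 0 , λ _ _ _ _ → cancel-self q 0<ε

_+ᴿ_ : ℝ → ℝ → ℝ
seq (x +ᴿ y) n = seq x n ℚ.+ seq y n
cauchy (x +ᴿ y) ε 0<ε with cauchy x (half ε) (half-pos 0<ε)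
                          | cauchy y (half ε) (half-pos 0<ε)
... | M , cx | N , cy = M ℕ.⊔ N , λ m n ≤m ≤n →
  triangle½ (seq x m ℚ.- seq x n) (seq y m ℚ.- seq y n)
    (+-regroup (seq x m) (seq y m) (seq x n) (seq y n))
    (cx m n (⊔₁ {M} ≤m) (⊔₁ {M} ≤n)) (cy m n (⊔₂ {M} ≤m) (⊔₂ {M} ≤n))

_*ᴿ_ : ℝ → ℝ → ℝ
seq (x *ᴿ y) n = seq x n ℚ.* seq y n
cauchy (x *ᴿ y) ε 0<ε =
  let A , 0<A , K , x<A = eventually-bounded (seq x) (cauchy x)
      D , 0<D , L , y<D = eventually-bounded (seq y) (cauchy y)
      M , cy = cauchy y (quot 0<A (half ε)) (quot-pos 0<A (half-pos 0<ε))
      N , cx = cauchy x (quot 0<D (half ε)) (quot-pos 0<D (half-pos 0<ε))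
  in (K ℕ.⊔ L) ℕ.⊔ (M ℕ.⊔ N) , λ m n ≤m ≤n →
    products-close 0<A 0<D (seq x m) (seq y m) (seq x n) (seq y n)
      (x<A m (⊔₁ {K} (⊔₁ {K ℕ.⊔ L} ≤m)))
      (y<D n (⊔₂ {K} (⊔₁ {K ℕ.⊔ L} ≤n)))
      (cy m n (⊔₁ {M} (⊔₂ {K ℕ.⊔ L} ≤m)) (⊔₁ {M} (⊔₂ {K ℕ.⊔ L} ≤n)))
      (cx m n (⊔₂ {M} (⊔₂ {K ℕ.⊔ L} ≤m)) (⊔₂ {M} (⊔₂ {K ℕ.⊔ L} ≤n)))

-ᴿ_ : ℝ → ℝ
seq (-ᴿ x) n = ℚ.- seq x n
cauchy (-ᴿ x) ε 0<ε with cauchy x ε 0<ε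
... | N , cx = N , λ m n ≤m ≤n →
  subst (λ z → ℚ.∣ z ∣ ℚ.< ε) (neg-regroup (seq x m) (seq x n))
    (swap (seq x m) (seq x n) (cx m n ≤m ≤n))

private
  ≃-isEquivalence : IsEquivalence _≃_
  ≃-isEquivalence = record
    { refl  = λ {x} → pointwise {x} {x} λ _ → refl
    ; sym   = λ {x} {y} x≃y ε 0<ε → let N , c = x≃y ε 0<ε in
                N , λ n ≤n → swap (seq x n) (seq y n) (c n ≤n)
    ; trans = λ {x} {y} {z} x≃y y≃z ε 0<ε →
                let M , c = x≃y (half ε) (half-pos 0<ε)
                    N , d = y≃z (half ε) (half-pos 0<ε)
                in M ℕ.⊔ N , λ n ≤n →
                  triangle½ (seq x n ℚ.- seq y n) (seq y n ℚ.- seq z n)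
                    (telescope (seq x n) (seq y n) (seq z n))
                    (c n (⊔₁ {M} ≤n)) (d n (⊔₂ {M} ≤n))
    }
    where
    telescope : ∀ a b c → (a ℚ.- b) ℚ.+ (b ℚ.- c) ≡ a ℚ.- c
    telescope = solve-∀ ℚ-ring

  +ᴿ-cong : ∀ {x y u v} → x ≃ y → u ≃ v → (x +ᴿ u) ≃ (y +ᴿ v)
  +ᴿ-cong {x} {y} {u} {v} x≃y u≃v ε 0<ε =
    let M , c = x≃y (half ε) (half-pos 0<ε)
        N , d = u≃v (half ε) (half-pos 0<ε)
    in M ℕ.⊔ N , λ n ≤n →
      triangle½ (seq x n ℚ.- seq y n) (seq u n ℚ.- seq v n)
        (+-regroup (seq x n) (seq u n) (seq y n) (seq v n))
        (c n (⊔₁ {M} ≤n)) (d n (⊔₂ {M} ≤n))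

  *ᴿ-cong : ∀ {x y u v} → x ≃ y → u ≃ v → (x *ᴿ u) ≃ (y *ᴿ v)
  *ᴿ-cong {x} {y} {u} {v} x≃y u≃v ε 0<ε =
    let A , 0<A , K , x<A = eventually-bounded (seq x) (cauchy x)
        D , 0<D , L , v<D = eventually-bounded (seq v) (cauchy v)
        M , c = u≃v (quot 0<A (half ε)) (quot-pos 0<A (half-pos 0<ε))
        N , d = x≃y (quot 0<D (half ε)) (quot-pos 0<D (half-pos 0<ε))
    in (K ℕ.⊔ L) ℕ.⊔ (M ℕ.⊔ N) , λ n ≤n →
      products-close 0<A 0<D (seq x n) (seq u n) (seq y n) (seq v n)
        (x<A n (⊔₁ {K} (⊔₁ {K ℕ.⊔ L} ≤n)))
        (v<D n (⊔₂ {K} (⊔₁ {K ℕ.⊔ L} ≤n)))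
        (c n (⊔₁ {M} (⊔₂ {K ℕ.⊔ L} ≤n)))
        (d n (⊔₂ {M} (⊔₂ {K ℕ.⊔ L} ≤n)))

  -ᴿ-cong : ∀ {x y} → x ≃ y → (-ᴿ x) ≃ (-ᴿ y)
  -ᴿ-cong {x} {y} x≃y ε 0<ε = let N , c = x≃y ε 0<ε in N , λ n ≤n →
    subst (λ z → ℚ.∣ z ∣ ℚ.< ε) (neg-regroup (seq x n) (seq y n))
      (swap (seq x n) (seq y n) (c n ≤n))

  ℝ-isCommutativeRing : IsCommutativeRing _≃_ _+ᴿ_ _*ᴿ_ -ᴿ_ (constᴿ 0ℚ) (constᴿ 1ℚ)
  ℝ-isCommutativeRing = record
    { isRing = record
      { +-isAbelianGroup = record
        { isGroup = record
          { isMonoid = record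
            { isSemigroup = record
              { isMagma = record
                { isEquivalence = ≃-isEquivalence
                ; ∙-cong = λ {x} {y} {u} {v} → +ᴿ-cong {x} {y} {u} {v}
                }
              ; assoc = λ x y z → pointwise {(x +ᴿ y) +ᴿ z} {x +ᴿ (y +ᴿ z)}
                          λ n → ℚ.+-assoc (seq x n) (seq y n) (seq z n)
              }
            ; identity =
                (λ x → pointwise {constᴿ 0ℚ +ᴿ x} {x} λ n → ℚ.+-identityˡ (seq x n)) ,
                (λ x → pointwise {x +ᴿ constᴿ 0ℚ} {x} λ n → ℚ.+-identityʳ (seq x n))
            }
          ; inverse =
              (λ x → pointwise {(-ᴿ x) +ᴿ x} {constᴿ 0ℚ} λ n → ℚ.+-inverseˡ (seq x n)) ,
              (λ x → pointwise {x +ᴿ -ᴿ x} {constᴿ 0ℚ} λ n → ℚ.+-inverseʳ (seq x n))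
          ; ⁻¹-cong = λ {x} {y} → -ᴿ-cong {x} {y}
          }
        ; comm = λ x y → pointwise {x +ᴿ y} {y +ᴿ x} λ n → ℚ.+-comm (seq x n) (seq y n)
        }
      ; *-cong = λ {x} {y} {u} {v} → *ᴿ-cong {x} {y} {u} {v}
      ; *-assoc = λ x y z → pointwise {(x *ᴿ y) *ᴿ z} {x *ᴿ (y *ᴿ z)}
                    λ n → ℚ.*-assoc (seq x n) (seq y n) (seq z n)
      ; *-identity =
          (λ x → pointwise {constᴿ 1ℚ *ᴿ x} {x} λ n → ℚ.*-identityˡ (seq x n)) ,
          (λ x → pointwise {x *ᴿ constᴿ 1ℚ} {x} λ n → ℚ.*-identityʳ (seq x n))
      ; distrib =
          (λ x y z → pointwise {x *ᴿ (y +ᴿ z)} {(x *ᴿ y) +ᴿ (x *ᴿ z)}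
             λ n → ℚ.*-distribˡ-+ (seq x n) (seq y n) (seq z n)) ,
          (λ x y z → pointwise {(y +ᴿ z) *ᴿ x} {(y *ᴿ x) +ᴿ (z *ᴿ x)}
             λ n → ℚ.*-distribʳ-+ (seq x n) (seq y n) (seq z n))
      }
    ; *-comm = λ x y → pointwise {x *ᴿ y} {y *ᴿ x} λ n → ℚ.*-comm (seq x n) (seq y n)
    }

ℝ-commutativeRing : CommutativeRing 0ℓ 0ℓ
ℝ-commutativeRing = record { isCommutativeRing = ℝ-isCommutativeRing }

------------------------------------------------------------------------
-- The polynomial ring R[X] in a set X of indeterminates, as the free
-- commutative R-algebra on X: ring expressions in the constants and the
-- indeterminates, modulo the commutative ring laws and the rules making
-- the inclusion of the constants a ring homomorphism.

module Polynomials {c ℓ} (R : CommutativeRing c ℓ) (X : Set) where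
  private module R = CommutativeRing R

  infixl 6 _⊕_
  infixl 7 _⊗_
  infix  8 ⊖_
  infix  4 _≈ₚ_

  data Polynomial : Set c where
    con : R.Carrier → Polynomial
    var : X → Polynomial
    _⊕_ : Polynomial → Polynomial → Polynomial
    _⊗_ : Polynomial → Polynomial → Polynomial
    ⊖_  : Polynomial → Polynomial

  0ₚ 1ₚ : Polynomial
  0ₚ = con R.0#
  1ₚ = con R.1#

  data _≈ₚ_ : Polynomial → Polynomial → Set (c ⊔ ℓ) where
    reflₚ  : ∀ {p} → p ≈ₚ p
    symₚ   : ∀ {p q} → p ≈ₚ q → q ≈ₚ p
    transₚ : ∀ {p q r} → p ≈ₚ q → q ≈ₚ r → p ≈ₚ r

    con-cong : ∀ {a b} → a R.≈ b → con a ≈ₚ con b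
    ⊕-cong   : ∀ {p p′ q q′} → p ≈ₚ p′ → q ≈ₚ q′ → (p ⊕ q) ≈ₚ (p′ ⊕ q′)
    ⊗-cong   : ∀ {p p′ q q′} → p ≈ₚ p′ → q ≈ₚ q′ → (p ⊗ q) ≈ₚ (p′ ⊗ q′)
    ⊖-cong   : ∀ {p p′} → p ≈ₚ p′ → (⊖ p) ≈ₚ (⊖ p′)

    con-⊕ : ∀ a b → con (a R.+ b) ≈ₚ (con a ⊕ con b)
    con-⊗ : ∀ a b → con (a R.* b) ≈ₚ (con a ⊗ con b)

    ⊕-assoc     : ∀ p q r → ((p ⊕ q) ⊕ r) ≈ₚ (p ⊕ (q ⊕ r))
    ⊕-comm      : ∀ p q → (p ⊕ q) ≈ₚ (q ⊕ p)
    ⊕-identityˡ : ∀ p → (0ₚ ⊕ p) ≈ₚ p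
    ⊖-inverseˡ  : ∀ p → (⊖ p ⊕ p) ≈ₚ 0ₚ
    ⊗-assoc     : ∀ p q r → ((p ⊗ q) ⊗ r) ≈ₚ (p ⊗ (q ⊗ r))
    ⊗-comm      : ∀ p q → (p ⊗ q) ≈ₚ (q ⊗ p)
    ⊗-identityˡ : ∀ p → (1ₚ ⊗ p) ≈ₚ p
    ⊗-distribˡ  : ∀ p q r → (p ⊗ (q ⊕ r)) ≈ₚ ((p ⊗ q) ⊕ (p ⊗ r))

  polynomialRing : CommutativeRing c (c ⊔ ℓ)
  polynomialRing = record
    { Carrier = Polynomial
    ; _≈_ = _≈ₚ_
    ; _+_ = _⊕_
    ; _*_ = _⊗_
    ; -_  = ⊖_
    ; 0#  = 0ₚ
    ; 1#  = 1ₚ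
    ; isCommutativeRing = record
      { isRing = record
        { +-isAbelianGroup = record
          { isGroup = record
            { isMonoid = record
              { isSemigroup = record
                { isMagma = record
                  { isEquivalence = record
                    { refl = reflₚ ; sym = symₚ ; trans = transₚ }
                  ; ∙-cong = ⊕-cong
                  }
                ; assoc = ⊕-assoc
                }
              ; identity = ⊕-identityˡ ,
                  λ p → transₚ (⊕-comm p 0ₚ) (⊕-identityˡ p)
              }
            ; inverse = ⊖-inverseˡ ,
                λ p → transₚ (⊕-comm p (⊖ p)) (⊖-inverseˡ p)
            ; ⁻¹-cong = ⊖-cong
            }
          ; comm = ⊕-comm
          }
        ; *-cong = ⊗-cong
        ; *-assoc = ⊗-assoc
        ; *-identity = ⊗-identityˡ ,
            λ p → transₚ (⊗-comm p 1ₚ) (⊗-identityˡ p)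
        ; distrib = ⊗-distribˡ ,
            λ p q r → transₚ (⊗-comm (q ⊕ r) p)
              (transₚ (⊗-distribˡ p q r) (⊕-cong (⊗-comm p q) (⊗-comm p r)))
        }
      ; *-comm = ⊗-comm
      }
    }

  module Derivative (_≟_ : DecidableEquality X) where

    ∂ : X → Polynomial → Polynomial
    ∂ x (con a) = 0ₚ
    ∂ x (var y) = if does (x ≟ y) then 1ₚ else 0ₚ
    ∂ x (p ⊕ q) = ∂ x p ⊕ ∂ x q
    ∂ x (p ⊗ q) = (∂ x p ⊗ q) ⊕ (p ⊗ ∂ x q)
    ∂ x (⊖ p)   = ⊖ ∂ x p

------------------------------------------------------------------------
-- The ring of fractions of a commutative ring.  Denominators are the
-- elements that are not zero divisors; in an integral domain these are
-- exactly the nonzero elements, and the result is the field of fractions.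

module Fractions {c ℓ} (R : CommutativeRing c ℓ) where
  open CommutativeRing R hiding (rawRing)

  Regular : Carrier → Set (c ⊔ ℓ)
  Regular d = ∀ x → d * x ≈ 0# → x ≈ 0#

  1-regular : Regular 1#
  1-regular x 1x≈0 = Eq.trans (Eq.sym (*-identityˡ x)) 1x≈0
    where module Eq = IsEquivalence isEquivalence

  *-regular : ∀ {d e} → Regular d → Regular e → Regular (d * e)
  *-regular {d} {e} rd re x dex≈0 = re x (rd (e * x) (Eq.trans (Eq.sym (*-assoc d e x)) dex≈0))
    where module Eq = IsEquivalence isEquivalence

  infix 7 _/_[_]

  record Fraction : Set (c ⊔ ℓ) where
    constructor _/_[_]
    field
      num     : Carrier
      den     : Carrier
      regular : Regular den

  fractionRing : RawRing (c ⊔ ℓ) ℓ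
  fractionRing = record
    { Carrier = Fraction
    ; _≈_ = λ where (a / d [ _ ]) (b / e [ _ ]) → a * e ≈ b * d
    ; _+_ = λ where (a / d [ rd ]) (b / e [ re ]) → (a * e + b * d) / d * e [ *-regular rd re ]
    ; _*_ = λ where (a / d [ rd ]) (b / e [ re ]) → a * b / d * e [ *-regular rd re ]
    ; -_  = λ where (a / d [ rd ]) → - a / d [ rd ]
    ; 0#  = 0# / 1# [ 1-regular ]
    ; 1#  = 1# / 1# [ 1-regular ]
    }

  fromRing : Carrier → Fraction
  fromRing a = a / 1# [ 1-regular ]

------------------------------------------------------------------------

module LinearAlgebra {c ℓ} (F : RawRing c ℓ) where
  open RawRing F
  open RawMonoidDefs +-rawMonoid using (sum)

  LinearlyIndependent : ∀ {I : Set} {m} → (Fin m → I → Carrier) → Set (c ⊔ ℓ)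
  LinearlyIndependent {I} {m} v =
    ∀ (a : Fin m → Carrier) →
    (∀ (θ : I) → sum (λ k → a k * v k θ) ≈ 0#) →
    ∀ k → a k ≈ 0#

------------------------------------------------------------------------
-- Directed graphs on the node set Fin n; D is the characteristic function
-- of the edge set.

record Digraph (n : ℕ) : Set where
  field
    D        : Fin n → Fin n → Bool
    loopless : ∀ i → ¬ T (D i i)

  infix 4 _⟶_

  _⟶_ : Fin n → Fin n → Set
  i ⟶ j = T (D i j)

  ch : Fin n → Subset n
  ch i = tabulate (D i)

  Adjacent : Fin n → Fin n → Set
  Adjacent i j = i ⟶ j ⊎ j ⟶ i

  Simple : Set
  Simple = ∀ i j → ¬ (i ⟶ j × j ⟶ i)

  Complete : Set
  Complete = ∀ i j → i ≢ j → Adjacent i j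

open Digraph public using (ch; Simple; Complete)

------------------------------------------------------------------------
-- The pair (i , j), i ≤ j, stands for the column K_{ij}.

record Column (n : ℕ) : Set where
  constructor column
  field
    row col  : Fin n
    .row≤col : row Fin.≤ col

------------------------------------------------------------------------

module PrecisionParameterization {n} (G : Digraph n) where
  open Digraph G

  -- The parameters are the indeterminates, and they index the Jacobian's rows.
  data Parameter : Set where
    λ[_] : ∀ {k l} → k ⟶ l → Parameter
    s    : Parameter

  infix 4 _≟ᴾ_

  _≟ᴾ_ : DecidableEquality Parameter
  s ≟ᴾ s = yes refl
  s ≟ᴾ λ[ _ ] = no λ ()
  λ[ _ ] ≟ᴾ s = no λ ()
  λ[_] {k} {l} e ≟ᴾ λ[_] {k′} {l′} e′ with k Fin.≟ k′ | l Fin.≟ l′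
  ... | yes refl | yes refl = yes (cong λ[_] (T-irrelevant e e′))
  ... | no k≢k′  | _        = no λ where refl → k≢k′ refl
  ... | yes _    | no l≢l′  = no λ where refl → l≢l′ refl

  open Polynomials ℝ-commutativeRing Parameter public
  open Derivative _≟ᴾ_ public
  open CommutativeRing polynomialRing using (_-_; +-rawMonoid)
  open RawMonoidDefs +-rawMonoid using (sum)

  Matrix : Set
  Matrix = Fin n → Fin n → Polynomial

  Λ : Matrix
  Λ i j with T? (D i j)
  ... | yes e = var λ[ e ]
  ... | no _  = 0ₚ

  I-Λ : Matrix
  I-Λ i j = (if does (i Fin.≟ j) then 1ₚ else 0ₚ) - Λ i j

  -- s (I − Λ)(I − Λ)ᵀ
  ψ : Matrix
  ψ i j = var s ⊗ sum (λ m → I-Λ i m ⊗ I-Λ j m)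

  open Fractions polynomialRing public

  J : Parameter → Column n → Fraction
  J θ (column i j _) = fromRing (∂ θ (ψ i j))

  open LinearAlgebra fractionRing public

-- The Jacobian matroid is given by its independent sets.  Its ground set
-- Column n depends only on the node set, and a set of columns is represented
-- by a list without repetition.

Independent : ∀ {n} → Digraph n → List (Column n) → Set
Independent G S = LinearlyIndependent (λ k θ → J θ (lookup S k))
  where open PrecisionParameterization G

SameJacobianMatroid : ∀ {n} → Digraph n → Digraph n → Set
SameJacobianMatroid {n} G₁ G₂ =
  ∀ (S : List (Column n)) → Unique S → Independent G₁ S ⇔ Independent G₂ S

{-# OPTIONS --safe #-}

-- The columns K_{pq} with p , q ≠ i only involve the rows s
-- and λ_{kl}, k ≠ i, of which there are |D| − |ch(i)| + 1; all columns together
-- involve |D| + 1 rows.  Both numbers are actual ranks when G is not complete, so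
-- the matroid determines |ch(i)| = |D| − (|D| − |ch(i)|).  The ranks are attained
-- because at suitable 0/1 values of the parameters a square submatrix becomes
-- triangular.  If only one of the graphs is complete, the edge columns of the
-- other one, a missing pair and one K_{ii} are independent in the complete graph
-- but too many for the incomplete one.

module Submission where

open import Defs
open import Data.Fin.Base using (Fin)
open import Data.Fin.Subset using (∣_∣)
open import Data.Nat.Base using (ℕ)
open import Data.Product using (∃)
open import Data.Sum.Base using (_⊎_)
open import Relation.Binary.PropositionalEquality using (_≢_)
open import Relation.Nullary using (¬_)

open import Algebra.Bundles using (CommutativeRing; module RawRing)
import Algebra.Definitions.RawMonoid as RawMonoidDefs
import Algebra.Properties.CommutativeMonoid.Sum as CommutativeMonoidSum
import Algebra.Properties.CommutativeSemigroup as CommutativeSemigroupProperties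
import Algebra.Properties.Ring as RingProperties
import Algebra.Properties.Semiring.Exp as SemiringExp
import Algebra.Properties.Semiring.Sum as SemiringSum
open import Data.Bool.Base using (Bool; true; false; T; if_then_else_; _∧_; not)
import Data.Bool.Properties as Bool
open import Data.Fin.Base as Fin using (zero; suc; punchIn; punchOut)
import Data.Fin.Properties as Fin
open import Data.List.Base using (List; []; _∷_; length; lookup; map; concat; tabulate)
open import Data.List.Properties using (length-map; length-++)
open import Data.List.Membership.Propositional using (_∈_; _∉_)
open import Data.List.Membership.Propositional.Properties
  using (∈-lookup; ∈-map⁺; ∈-map⁻; ∈-concat⁺′; ∈-concat⁻′; ∈-tabulate⁺; ∈-tabulate⁻)
open import Data.List.Relation.Unary.All as All using (All)
import Data.List.Relation.Unary.All.Properties as All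
open import Data.List.Relation.Unary.AllPairs using ([]; _∷_)
import Data.List.Relation.Unary.AllPairs.Properties as AllPairs
open import Data.List.Relation.Unary.Any using (here; there; index)
open import Data.List.Relation.Unary.Any.Properties using (lookup-index)
open import Data.List.Relation.Unary.Unique.Propositional using (Unique)
import Data.List.Relation.Unary.Unique.Propositional.Properties as Unique
open import Data.Nat.Base as ℕ using (zero; suc; s≤s)
import Data.Nat.Properties as ℕ
open import Data.Product using (∃₂; _×_; _,_; proj₁; proj₂)
open import Data.Rational.Base using (1ℚ; ½)
import Data.Rational.Properties as ℚ
open import Data.Sum.Base using (inj₁; inj₂)
import Data.Vec.Base as Vec
open import Function.Base using (_∘_; id; case_of_)
open import Function.Bundles using (Equivalence; mk⇔)
open import Level using (_⊔_)
open import Relation.Binary.PropositionalEquality as ≡ using (_≡_)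
import Relation.Binary.Reasoning.Setoid as SetoidReasoning
open import Relation.Nullary using (Dec; yes; no; does; contradiction; recompute; ¬?)
open import Relation.Nullary.Decidable
  using (T?; dec-false; dec-true; _×-dec_; _⊎-dec_; decidable-stable)

-- Linear systems over a commutative ring

-- Independence over the fractions is therefore traded for triviality of the kernel over the
-- polynomial ring itself. The bound of independent columns by rows is then proved over an arbitrary
-- nontrivial commutative ring, and independence is lifted from a 0/1 point by expanding kernel
-- vectors along a line instead of evaluating determinants.
--
-- The delicate count is the one that avoids `i`. The natural column for λ_{ki} is K_{ki}, which
-- involves `i`, so K_{kk} has to take its place. If all other nodes are parents of `i`, this uses
-- up every available diagonal column and leaves none for `s`; a nonadjacent pair frees one. In a
-- simple complete graph with no edge leaving `i`, the columns avoiding `i` are indeed one fewer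
-- than the rows to be served.

module Sums {c ℓ} (A : CommutativeRing c ℓ) where
  open CommutativeRing A hiding (zero)
  open SemiringSum semiring public

  sum-zero : ∀ {n} {f : Fin n → Carrier} → (∀ i → f i ≈ 0#) → sum f ≈ 0#
  sum-zero {n} f≈0 = trans (sum-cong-≋ f≈0) (sum-replicate-zero n)

  sum-single : ∀ {n} (f : Fin n → Carrier) i → (∀ j → j ≢ i → f j ≈ 0#) → sum f ≈ f i
  sum-single {suc n} f i f≈0 = begin
    sum f                      ≈⟨ sum-remove f ⟩
    f i + sum (f ∘ punchIn i)  ≈⟨ +-congˡ (sum-zero λ j → f≈0 (punchIn i j) (Fin.punchInᵢ≢i i j)) ⟩
    f i + 0#                   ≈⟨ +-identityʳ (f i) ⟩
    f i                        ∎
    where open SetoidReasoning setoid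

  -- The rows are indexed by an arbitrary type, so that the Jacobian can keep `Parameter` as its row
  -- index.
  Injective : ∀ {i} {I : Set i} {m} → (I → Fin m → Carrier) → Set (i ⊔ c ⊔ ℓ)
  Injective {m = m} M = ∀ (x : Fin m → Carrier) → (∀ i → sum (λ j → x j * M i j) ≈ 0#) → ∀ j → x j ≈ 0#

-- The image of A in A[1/a]: only the equality of A changes, so no inverse of a
-- has to be adjoined.

module PowerTorsion {c ℓ} (A : CommutativeRing c ℓ) (a : CommutativeRing.Carrier A) where
  open CommutativeRing A hiding (zero)
  open SemiringExp semiring
  open SetoidReasoning setoid
  open CommutativeSemigroupProperties *-commutativeSemigroup using (interchange)

  infix 4 _~_

  _~_ : Carrier → Carrier → Set ℓ
  x ~ y = ∃ λ N → a ^ N * x ≈ a ^ N * y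

  ≈⇒~ : ∀ {x y} → x ≈ y → x ~ y
  ≈⇒~ x≈y = 0 , *-congˡ x≈y

  ^-* : ∀ M N {x y} → a ^ N * x ≈ a ^ N * y → a ^ (M ℕ.+ N) * x ≈ a ^ (M ℕ.+ N) * y
  ^-* M N {x} {y} eq = begin
    a ^ (M ℕ.+ N) * x    ≈⟨ *-congʳ (^-homo-* a M N) ⟩
    (a ^ M * a ^ N) * x  ≈⟨ *-assoc _ _ _ ⟩
    a ^ M * (a ^ N * x)  ≈⟨ *-congˡ eq ⟩
    a ^ M * (a ^ N * y)  ≈⟨ *-assoc _ _ _ ⟨
    (a ^ M * a ^ N) * y  ≈⟨ *-congʳ (^-homo-* a M N) ⟨
    a ^ (M ℕ.+ N) * y    ∎

  ^-*′ : ∀ M N {x y} → a ^ N * x ≈ a ^ N * y → a ^ (N ℕ.+ M) * x ≈ a ^ (N ℕ.+ M) * y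
  ^-*′ M N {x} {y} eq =
    ≡.subst (λ K → a ^ K * x ≈ a ^ K * y) (ℕ.+-comm M N) (^-* M N eq)

  private
    ~-trans : ∀ {x y z} → x ~ y → y ~ z → x ~ z
    ~-trans (M , p) (N , q) = M ℕ.+ N , trans (^-*′ N M p) (^-* M N q)

    +-cong~ : ∀ {x y u v} → x ~ y → u ~ v → x + u ~ y + v
    +-cong~ {x} {y} {u} {v} (M , p) (N , q) = M ℕ.+ N , (begin
      a ^ (M ℕ.+ N) * (x + u)                ≈⟨ distribˡ _ _ _ ⟩
      a ^ (M ℕ.+ N) * x + a ^ (M ℕ.+ N) * u  ≈⟨ +-cong (^-*′ N M p) (^-* M N q) ⟩
      a ^ (M ℕ.+ N) * y + a ^ (M ℕ.+ N) * v  ≈⟨ distribˡ _ _ _ ⟨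
      a ^ (M ℕ.+ N) * (y + v)                ∎)

    *-cong~ : ∀ {x y u v} → x ~ y → u ~ v → x * u ~ y * v
    *-cong~ {x} {y} {u} {v} (M , p) (N , q) = M ℕ.+ N , (begin
      a ^ (M ℕ.+ N) * (x * u)        ≈⟨ *-congʳ (^-homo-* a M N) ⟩
      (a ^ M * a ^ N) * (x * u)      ≈⟨ interchange _ _ _ _ ⟩
      (a ^ M * x) * (a ^ N * u)      ≈⟨ *-cong p q ⟩
      (a ^ M * y) * (a ^ N * v)      ≈⟨ interchange _ _ _ _ ⟩
      (a ^ M * a ^ N) * (y * v)      ≈⟨ *-congʳ (^-homo-* a M N) ⟨
      a ^ (M ℕ.+ N) * (y * v)        ∎)

    neg-cong~ : ∀ {x y} → x ~ y → - x ~ - y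
    neg-cong~ {x} {y} (N , p) = N , (begin
      a ^ N * - x    ≈⟨ -‿distribʳ-* _ _ ⟨
      - (a ^ N * x)  ≈⟨ -‿cong p ⟩
      - (a ^ N * y)  ≈⟨ -‿distribʳ-* _ _ ⟩
      a ^ N * - y    ∎)
      where open RingProperties ring using (-‿distribʳ-*)

  quotient : CommutativeRing c ℓ
  quotient = record
    { Carrier = Carrier
    ; _≈_ = _~_
    ; _+_ = _+_
    ; _*_ = _*_
    ; -_  = -_
    ; 0#  = 0#
    ; 1#  = 1#
    ; isCommutativeRing = record
      { isRing = record
        { +-isAbelianGroup = record
          { isGroup = record
            { isMonoid = record
              { isSemigroup = record
                { isMagma = record
                  { isEquivalence = record
                    { refl  = ≈⇒~ refl
                    ; sym   = λ (N , p) → N , sym p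
                    ; trans = ~-trans
                    }
                  ; ∙-cong = +-cong~
                  }
                ; assoc = λ x y z → ≈⇒~ (+-assoc x y z)
                }
              ; identity = (λ x → ≈⇒~ (+-identityˡ x)) , (λ x → ≈⇒~ (+-identityʳ x))
              }
            ; inverse = (λ x → ≈⇒~ (-‿inverseˡ x)) , (λ x → ≈⇒~ (-‿inverseʳ x))
            ; ⁻¹-cong = neg-cong~
            }
          ; comm = λ x y → ≈⇒~ (+-comm x y)
          }
        ; *-cong = *-cong~
        ; *-assoc = λ x y z → ≈⇒~ (*-assoc x y z)
        ; *-identity = (λ x → ≈⇒~ (*-identityˡ x)) , (λ x → ≈⇒~ (*-identityʳ x))
        ; distrib = (λ x y z → ≈⇒~ (distribˡ x y z)) , (λ x y z → ≈⇒~ (distribʳ x y z))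
        }
      ; *-comm = λ x y → ≈⇒~ (*-comm x y)
      }
    }

  regular : ∀ {x} → a * x ~ 0# → x ~ 0#
  regular {x} (N , p) = N ℕ.+ 1 , (begin
    a ^ (N ℕ.+ 1) * x    ≈⟨ *-congʳ (^-homo-* a N 1) ⟩
    (a ^ N * a ^ 1) * x  ≈⟨ *-congʳ (*-congˡ (*-identityʳ a)) ⟩
    (a ^ N * a) * x      ≈⟨ *-assoc _ _ _ ⟩
    a ^ N * (a * x)      ≈⟨ p ⟩
    a ^ N * 0#           ≈⟨ zeroʳ _ ⟩
    0#                   ≈⟨ zeroʳ _ ⟨
    a ^ (N ℕ.+ 1) * 0#   ∎)

  private
    module S = Sums A
    module Q = Sums quotient

  common : ∀ {n} {x : Fin n → Carrier} → (∀ i → x i ~ 0#) →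
           ∃ λ N → ∀ i → a ^ N * x i ≈ 0#
  common {zero}  x~0 = 0 , λ ()
  common {suc n} x~0 with x~0 zero | common (x~0 ∘ suc)
  ... | M , p | N , q = M ℕ.+ N , λ where
    zero    → trans (^-*′ N M p) (zeroʳ _)
    (suc i) → trans (^-* M N (trans (q i) (sym (zeroʳ _)))) (zeroʳ _)

  -- Finitely many rows share one exponent `N`, and `a ^ N` times the vector then lies in the kernel
  -- over `A`.
  injective : ∀ {r m} {M : Fin r → Fin m → Carrier} → S.Injective M → Q.Injective M
  injective {M = M} inj x Mx~0 j with common Mx~0
  ... | N , p = N , trans (inj (λ j → a ^ N * x j) (λ i → begin
    S.sum (λ j → (a ^ N * x j) * M i j)  ≈⟨ S.sum-cong-≋ (λ j → *-assoc (a ^ N) (x j) (M i j)) ⟩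
    S.sum (λ j → a ^ N * (x j * M i j))  ≈⟨ S.*-distribˡ-sum (a ^ N) (λ j → x j * M i j) ⟨
    a ^ N * S.sum (λ j → x j * M i j)    ≈⟨ p i ⟩
    0#                                   ∎) j) (sym (zeroʳ _))

-- After Richman, "Nontrivial uses of trivial rings": a pivot that is made
-- regular can be eliminated, so by induction every entry of the first
-- column is nilpotent, and a nilpotent column has a nonzero annihilator.

module Elimination {c ℓ} (A : CommutativeRing c ℓ) where
  open CommutativeRing A hiding (zero)
  open Sums A
  open SetoidReasoning setoid

  open RingProperties ring using (-‿distribʳ-*; -0#≈0#; -‿+-comm)

  private
    minor-entry : ∀ x a b d e → - (x * b * d) + x * a * e ≈ x * (a * e - b * d)
    minor-entry x a b d e = begin
      - (x * b * d) + x * a * e        ≈⟨ +-comm _ _ ⟩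
      x * a * e - x * b * d            ≈⟨ +-cong (*-assoc x a e) (-‿cong (*-assoc x b d)) ⟩
      x * (a * e) - x * (b * d)        ≈⟨ +-congˡ (-‿distribʳ-* x (b * d)) ⟩
      x * (a * e) + x * - (b * d)      ≈⟨ distribˡ x (a * e) (- (b * d)) ⟨
      x * (a * e - b * d)              ∎

  -- The Schur complement of the pivot multiplied by the pivot: its entries are 2×2 minors, so no
  -- division occurs.
  schur : ∀ {r m} → Fin (suc r) → (Fin (suc r) → Fin (suc m) → Carrier) → Fin r → Fin m → Carrier
  schur p M i j = M p zero * M (punchIn p i) (suc j) - M p (suc j) * M (punchIn p i) zero

  schur-injective : ∀ {r m} p (M : Fin (suc r) → Fin (suc m) → Carrier) →
    (∀ x → M p zero * x ≈ 0# → x ≈ 0#) → Injective M → Injective (schur p M)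
  schur-injective {r} {m} p M a-regular inj x Sx≈0 j =
    a-regular (x j) (trans (*-comm a (x j)) (inj y My≈0 (suc j)))
    where
    a : Carrier
    a = M p zero

    -- Back substitution multiplied through by the pivot: the pivot row fixes the first coordinate,
    -- and scaling the others avoids dividing by `a`.
    y : Fin (suc m) → Carrier
    y zero    = - sum (λ j → x j * M p (suc j))
    y (suc j) = x j * a

    row : ∀ i → sum (λ j → y j * M i j) ≈
                sum (λ j → x j * (a * M i (suc j) - M p (suc j) * M i zero))
    row i = begin
      - sum (λ j → x j * M p (suc j)) * M i zero + tail
        ≈⟨ +-congʳ (-‿distribˡ-* _ _) ⟨
      - (sum (λ j → x j * M p (suc j)) * M i zero) + tail
        ≈⟨ +-congʳ (-‿cong (*-distribʳ-sum (M i zero) (λ j → x j * M p (suc j)))) ⟩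
      - sum (λ j → x j * M p (suc j) * M i zero) + tail
        ≈⟨ +-congʳ (sum-neg (λ j → x j * M p (suc j) * M i zero)) ⟩
      sum (λ j → - (x j * M p (suc j) * M i zero)) + tail
        ≈⟨ ∑-distrib-+ (λ j → - (x j * M p (suc j) * M i zero)) _ ⟨
      sum (λ j → - (x j * M p (suc j) * M i zero) + x j * a * M i (suc j))
        ≈⟨ sum-cong-≋ (λ j → minor-entry (x j) a (M p (suc j)) (M i zero) (M i (suc j))) ⟩
      sum (λ j → x j * (a * M i (suc j) - M p (suc j) * M i zero)) ∎
      where
      open RingProperties ring using (-‿distribˡ-*)
      tail : Carrier
      tail = sum (λ j → x j * a * M i (suc j))
      sum-neg : ∀ {n} (f : Fin n → Carrier) → - sum f ≈ sum (λ j → - f j)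
      sum-neg {zero}  f = -0#≈0#
      sum-neg {suc n} f = trans (sym (-‿+-comm _ _)) (+-congˡ (sum-neg (f ∘ suc)))

    My≈0 : ∀ i → sum (λ j → y j * M i j) ≈ 0#
    My≈0 i with p Fin.≟ i
    ... | no p≢i = trans (row i)
      (≡.subst (λ i → sum (λ j → x j * (a * M i (suc j) - M p (suc j) * M i zero)) ≈ 0#)
        (Fin.punchIn-punchOut p≢i) (Sx≈0 (punchOut p≢i)))
    ... | yes ≡.refl = trans (row p) (sum-zero λ j → begin
      x j * (a * M p (suc j) - M p (suc j) * a)  ≈⟨ *-congˡ (+-congʳ (*-comm _ _)) ⟩
      x j * (M p (suc j) * a - M p (suc j) * a)  ≈⟨ *-congˡ (-‿inverseʳ _) ⟩
      x j * 0#                                   ≈⟨ zeroʳ _ ⟩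
      0#                                         ∎)

module Annihilator {c ℓ} (A : CommutativeRing c ℓ) where
  open CommutativeRing A hiding (zero)
  open SemiringExp semiring
  open CommutativeSemigroupProperties *-commutativeSemigroup using (x∙yz≈y∙xz)

  -- Contrapositive form, by induction on the entries. If the later entries kill `y`, they also kill
  -- every multiple of `y`, so faithfulness strips the powers of the first entry off
  -- `a zero ^ N * y` one at a time. Hence the later entries alone are already faithful, and with no
  -- entries left everything is zero.
  nilpotent-annihilator : ∀ {r} (a : Fin r → Carrier) → (∀ i → ∃ λ N → a i ^ N ≈ 0#) →
    (∀ y → (∀ i → a i * y ≈ 0#) → y ≈ 0#) → ∀ y → y ≈ 0#
  nilpotent-annihilator {zero}  a nil faithful y = faithful y λ ()
  nilpotent-annihilator {suc r} a nil faithful =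
    nilpotent-annihilator (a ∘ suc) (nil ∘ suc) faithful′
    where
    module _ (y : Carrier) (ay≈0 : ∀ i → a (suc i) * y ≈ 0#) where
      descend : ∀ N → a zero ^ N * y ≈ 0# → y ≈ 0#
      descend zero    eq = trans (sym (*-identityˡ y)) eq
      descend (suc N) eq = descend N (faithful (a zero ^ N * y) λ where
        zero    → trans (sym (*-assoc _ _ _)) eq
        (suc i) → trans (x∙yz≈y∙xz _ _ _) (trans (*-congˡ (ay≈0 i)) (zeroʳ _)))

    faithful′ : ∀ y → (∀ i → a (suc i) * y ≈ 0#) → y ≈ 0#
    faithful′ y ay≈0 with nil zero
    ... | N , eq = descend y ay≈0 N (trans (*-congʳ eq) (zeroˡ y))

wide-injective⇒trivial : ∀ {c ℓ} r (A : CommutativeRing c ℓ) → let open CommutativeRing A in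
  (M : Fin r → Fin (suc r) → Carrier) → Sums.Injective A M → 1# ≈ 0#
wide-injective⇒trivial zero    A M inj = inj (λ _ → CommutativeRing.1# A) (λ ()) zero
wide-injective⇒trivial (suc r) A M inj =
  nilpotent-annihilator (λ i → M i zero) nilpotent faithful 1#
  where
  open CommutativeRing A hiding (zero)
  open Sums A
  open SemiringExp semiring
  open Annihilator A
  open SetoidReasoning setoid

  nilpotent : ∀ i → ∃ λ N → M i zero ^ N ≈ 0#
  nilpotent i =
    -- Once the pivot is regular, the smaller matrix makes the quotient trivial, and 1 = 0 there
    -- means that a power of the pivot vanishes in `A`.
    let N , eq = wide-injective⇒trivial r quotient (schur i M)
                   (schur-injective i M (λ _ → regular) (injective {M = M} inj))
    in N , trans (sym (*-identityʳ _)) (trans eq (zeroʳ _))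
    where
    open PowerTorsion A (M i zero)
    open Elimination quotient

  faithful : ∀ y → (∀ i → M i zero * y ≈ 0#) → y ≈ 0#
  faithful y ay≈0 = inj (λ where zero → y ; (suc _) → 0#) (λ i → begin
    y * M i zero + sum (λ j → 0# * M i (suc j))  ≈⟨ +-cong (*-comm _ _) (sum-zero λ j → zeroˡ (M i (suc j))) ⟩
    M i zero * y + 0#                            ≈⟨ +-identityʳ _ ⟩
    M i zero * y                                 ≈⟨ ay≈0 i ⟩
    0#                                           ∎) zero

-- The order on naturals is decidable, so refuting `r < m` is enough; surplus columns are dropped
-- until exactly one more than the number of rows remains.
injective⇒≤ : ∀ {c ℓ} (A : CommutativeRing c ℓ) → let open CommutativeRing A in
  ¬ 1# ≈ 0# → ∀ {r m} (M : Fin r → Fin m → Carrier) → Sums.Injective A M → m ℕ.≤ r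
injective⇒≤ A 1≉0 {r} {m} M inj = ℕ.≮⇒≥ λ r<m → 1≉0 (contradict r<m)
  where
  open CommutativeRing A hiding (zero)
  open Sums A

  drop-columns : ∀ k (N : Fin r → Fin (k ℕ.+ suc r) → Carrier) → Injective N → 1# ≈ 0#
  drop-columns zero    N inj = wide-injective⇒trivial r A N inj
  drop-columns (suc k) N inj = drop-columns k (λ i j → N i (suc j)) λ x Nx≈0 j →
    inj (λ where zero → 0# ; (suc j) → x j)
      (λ i → trans (+-cong (zeroˡ _) (Nx≈0 i)) (+-identityˡ 0#)) (suc j)

  contradict : r ℕ.< m → 1# ≈ 0#
  contradict r<m with ℕ.m≤n⇒∃[o]m+o≡n r<m
  ... | k , eq with ≡.trans (ℕ.+-comm k (suc r)) eq
  ... | ≡.refl = drop-columns k M inj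

-- Power series and specialization

module PowerSeries {c ℓ} (A : CommutativeRing c ℓ) where
  open CommutativeRing A hiding (zero)
  open SetoidReasoning setoid
  open CommutativeSemigroupProperties +-commutativeSemigroup using ()
    renaming (interchange to +-interchange; x∙yz≈y∙xz to x+yz≈y+xz)
  open RingProperties ring using (-‿+-comm; -0#≈0#)
  open Sums A

  -- Without a degree bound the additive laws hold coefficientwise and products need no bookkeeping;
  -- `SumsTo` singles out the finite series where a value at 1 is wanted.
  Series : Set c
  Series = ℕ → Carrier

  infix  4 _≋_
  infixl 6 _+ˢ_
  infixl 7 _*ˢ_ _·_

  _≋_ : Series → Series → Set ℓ
  f ≋ g = ∀ n → f n ≈ g n

  const : Carrier → Series
  const a zero    = a
  const a (suc _) = 0#

  _+ˢ_ : Series → Series → Series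
  (f +ˢ g) n = f n + g n

  _·_ : Carrier → Series → Series
  (a · f) n = a * f n

  _*ˢ_ : Series → Series → Series
  (f *ˢ g) zero    = f 0 * g 0
  (f *ˢ g) (suc n) = f 0 * g (suc n) + ((f ∘ suc) *ˢ g) n

  *ˢ-cong : ∀ {f f′ g g′} → f ≋ f′ → g ≋ g′ → f *ˢ g ≋ f′ *ˢ g′
  *ˢ-cong p q zero    = *-cong (p 0) (q 0)
  *ˢ-cong p q (suc n) = +-cong (*-cong (p 0) (q (suc n))) (*ˢ-cong (p ∘ suc) q n)

  *ˢ-zeroˡ : ∀ {f} g → (∀ n → f n ≈ 0#) → ∀ n → (f *ˢ g) n ≈ 0#
  *ˢ-zeroˡ g f≈0 zero    = trans (*-congʳ (f≈0 0)) (zeroˡ _)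
  *ˢ-zeroˡ g f≈0 (suc n) =
    trans (+-cong (trans (*-congʳ (f≈0 0)) (zeroˡ _)) (*ˢ-zeroˡ g (f≈0 ∘ suc) n)) (+-identityˡ 0#)

  const-*ˢ : ∀ a f → const a *ˢ f ≋ a · f
  const-*ˢ a f zero    = refl
  const-*ˢ a f (suc n) = trans (+-congˡ (*ˢ-zeroˡ f (λ _ → refl) n)) (+-identityʳ _)

  ·-*ˢ : ∀ a f g → (a · f) *ˢ g ≋ a · (f *ˢ g)
  ·-*ˢ a f g zero    = *-assoc _ _ _
  ·-*ˢ a f g (suc n) = begin
    a * f 0 * g (suc n) + ((a · (f ∘ suc)) *ˢ g) n    ≈⟨ +-cong (*-assoc _ _ _) (·-*ˢ a (f ∘ suc) g n) ⟩
    a * (f 0 * g (suc n)) + a * ((f ∘ suc) *ˢ g) n    ≈⟨ distribˡ _ _ _ ⟨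
    a * (f 0 * g (suc n) + ((f ∘ suc) *ˢ g) n)        ∎

  *ˢ-distribʳ : ∀ h f g → (f +ˢ g) *ˢ h ≋ f *ˢ h +ˢ g *ˢ h
  *ˢ-distribʳ h f g zero    = distribʳ _ _ _
  *ˢ-distribʳ h f g (suc n) = begin
    (f 0 + g 0) * h (suc n) + (((f ∘ suc) +ˢ (g ∘ suc)) *ˢ h) n
      ≈⟨ +-cong (distribʳ _ _ _) (*ˢ-distribʳ h (f ∘ suc) (g ∘ suc) n) ⟩
    (f 0 * h (suc n) + g 0 * h (suc n)) + (((f ∘ suc) *ˢ h) n + ((g ∘ suc) *ˢ h) n)
      ≈⟨ +-interchange _ _ _ _ ⟩
    (f *ˢ h +ˢ g *ˢ h) (suc n) ∎

  *ˢ-distribˡ : ∀ f g h → f *ˢ (g +ˢ h) ≋ f *ˢ g +ˢ f *ˢ h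
  *ˢ-distribˡ f g h zero    = distribˡ _ _ _
  *ˢ-distribˡ f g h (suc n) = trans
    (+-cong (distribˡ _ _ _) (*ˢ-distribˡ (f ∘ suc) g h n))
    (+-interchange _ _ _ _)

  *ˢ-assoc : ∀ f g h → (f *ˢ g) *ˢ h ≋ f *ˢ (g *ˢ h)
  *ˢ-assoc f g h zero    = *-assoc _ _ _
  *ˢ-assoc f g h (suc n) = begin
    f 0 * g 0 * h (suc n) + ((f 0 · (g ∘ suc) +ˢ (f ∘ suc) *ˢ g) *ˢ h) n
      ≈⟨ +-cong (*-assoc _ _ _) (*ˢ-distribʳ h (f 0 · (g ∘ suc)) ((f ∘ suc) *ˢ g) n) ⟩
    f 0 * (g 0 * h (suc n)) + (((f 0 · (g ∘ suc)) *ˢ h) n + (((f ∘ suc) *ˢ g) *ˢ h) n)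
      ≈⟨ +-congˡ (+-cong (·-*ˢ (f 0) (g ∘ suc) h n) (*ˢ-assoc (f ∘ suc) g h n)) ⟩
    f 0 * (g 0 * h (suc n)) + (f 0 * ((g ∘ suc) *ˢ h) n + ((f ∘ suc) *ˢ (g *ˢ h)) n)
      ≈⟨ +-assoc _ _ _ ⟨
    f 0 * (g 0 * h (suc n)) + f 0 * ((g ∘ suc) *ˢ h) n + ((f ∘ suc) *ˢ (g *ˢ h)) n
      ≈⟨ +-congʳ (distribˡ _ _ _) ⟨
    (f *ˢ (g *ˢ h)) (suc n) ∎

  -- The definition of the product peels the first factor; commutativity also needs the second one
  -- peeled.
  *ˢ-sucʳ : ∀ f g n → (f *ˢ g) (suc n) ≈ f (suc n) * g 0 + (f *ˢ (g ∘ suc)) n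
  *ˢ-sucʳ f g zero    = +-comm _ _
  *ˢ-sucʳ f g (suc n) = trans (+-congˡ (*ˢ-sucʳ (f ∘ suc) g n)) (x+yz≈y+xz _ _ _)

  *ˢ-comm : ∀ f g → f *ˢ g ≋ g *ˢ f
  *ˢ-comm f g zero    = *-comm _ _
  *ˢ-comm f g (suc n) =
    trans (+-cong (*-comm _ _) (*ˢ-comm (f ∘ suc) g n)) (sym (*ˢ-sucʳ g f n))

  *ˢ-identityˡ : ∀ f → const 1# *ˢ f ≋ f
  *ˢ-identityˡ f n = trans (const-*ˢ 1# f n) (*-identityˡ (f n))

  const0 : ∀ n → const 0# n ≈ 0#
  const0 zero    = refl
  const0 (suc _) = refl

  powerSeriesRing : CommutativeRing c ℓ
  powerSeriesRing = record
    { Carrier = Series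
    ; _≈_ = _≋_
    ; _+_ = _+ˢ_
    ; _*_ = _*ˢ_
    ; -_  = λ f n → - f n
    ; 0#  = const 0#
    ; 1#  = const 1#
    ; isCommutativeRing = record
      { isRing = record
        { +-isAbelianGroup = record
          { isGroup = record
            { isMonoid = record
              { isSemigroup = record
                { isMagma = record
                  { isEquivalence = record
                    { refl  = λ _ → refl
                    ; sym   = λ p n → sym (p n)
                    ; trans = λ p q n → trans (p n) (q n)
                    }
                  ; ∙-cong = λ p q n → +-cong (p n) (q n)
                  }
                ; assoc = λ f g h n → +-assoc (f n) (g n) (h n)
                }
              ; identity = (λ f n → trans (+-congʳ (const0 n)) (+-identityˡ (f n)))
                         , (λ f n → trans (+-congˡ (const0 n)) (+-identityʳ (f n)))
              }
            ; inverse = (λ f n → trans (-‿inverseˡ (f n)) (sym (const0 n)))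
                      , (λ f n → trans (-‿inverseʳ (f n)) (sym (const0 n)))
            ; ⁻¹-cong = λ p n → -‿cong (p n)
            }
          ; comm = λ f g n → +-comm (f n) (g n)
          }
        ; *-cong = *ˢ-cong
        ; *-assoc = *ˢ-assoc
        ; *-identity = *ˢ-identityˡ , λ f n → trans (*ˢ-comm f (const 1#) n) (*ˢ-identityˡ f n)
        ; distrib = *ˢ-distribˡ , *ˢ-distribʳ
        }
      ; *-comm = *ˢ-comm
      }
    }

  -- f SumsTo v : f is a polynomial, and v is its value at 1.
  data _SumsTo_ : Series → Carrier → Set (c ⊔ ℓ) where
    nil  : ∀ {f v} → (∀ n → f n ≈ 0#) → v ≈ 0# → f SumsTo v
    cons : ∀ {f v w} → (f ∘ suc) SumsTo w → v ≈ f 0 + w → f SumsTo v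

  SumsTo-resp : ∀ {f g v w} → f ≋ g → v ≈ w → f SumsTo v → g SumsTo w
  SumsTo-resp f≋g v≈w (nil f≈0 v≈0) = nil (λ n → trans (sym (f≋g n)) (f≈0 n)) (trans (sym v≈w) v≈0)
  SumsTo-resp f≋g v≈w (cons σ eq)   =
    cons (SumsTo-resp (f≋g ∘ suc) refl σ) (trans (sym v≈w) (trans eq (+-congʳ (f≋g 0))))

  SumsTo-zero : ∀ {f v} → f SumsTo v → (∀ n → f n ≈ 0#) → v ≈ 0#
  SumsTo-zero (nil _ v≈0)  f≈0 = v≈0
  SumsTo-zero (cons σ eq)  f≈0 =
    trans eq (trans (+-cong (f≈0 0) (SumsTo-zero σ (f≈0 ∘ suc))) (+-identityˡ 0#))

  SumsTo-const : ∀ a → const a SumsTo a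
  SumsTo-const a = cons (nil (λ _ → refl) refl) (sym (+-identityʳ a))

  SumsTo-+ : ∀ {f g v w} → f SumsTo v → g SumsTo w → (f +ˢ g) SumsTo (v + w)
  SumsTo-+ (nil f≈0 v≈0) τ =
    SumsTo-resp (λ n → sym (trans (+-congʳ (f≈0 n)) (+-identityˡ _)))
                (sym (trans (+-congʳ v≈0) (+-identityˡ _))) τ
  SumsTo-+ σ@(cons _ _) (nil g≈0 w≈0) =
    SumsTo-resp (λ n → sym (trans (+-congˡ (g≈0 n)) (+-identityʳ _)))
                (sym (trans (+-congˡ w≈0) (+-identityʳ _))) σ
  SumsTo-+ (cons σ v≈) (cons τ w≈) =
    cons (SumsTo-+ σ τ) (trans (+-cong v≈ w≈) (+-interchange _ _ _ _))

  SumsTo-neg : ∀ {f v} → f SumsTo v → (λ n → - f n) SumsTo (- v)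
  SumsTo-neg (nil f≈0 v≈0) =
    nil (λ n → trans (-‿cong (f≈0 n)) -0#≈0#) (trans (-‿cong v≈0) -0#≈0#)
  SumsTo-neg (cons σ eq) =
    cons (SumsTo-neg σ) (trans (-‿cong eq) (sym (-‿+-comm _ _)))

  SumsTo-· : ∀ a {f v} → f SumsTo v → (a · f) SumsTo (a * v)
  SumsTo-· a (nil f≈0 v≈0) =
    nil (λ n → trans (*-congˡ (f≈0 n)) (zeroʳ a)) (trans (*-congˡ v≈0) (zeroʳ a))
  SumsTo-· a (cons σ eq) = cons (SumsTo-· a σ) (trans (*-congˡ eq) (distribˡ _ _ _))

  SumsTo-* : ∀ {f g v w} → f SumsTo v → g SumsTo w → (f *ˢ g) SumsTo (v * w)
  SumsTo-* {g = g} (nil f≈0 v≈0) τ = nil (*ˢ-zeroˡ g f≈0) (trans (*-congʳ v≈0) (zeroˡ _))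
  SumsTo-* {f} {g} {v} {w} (cons {w = u} σ eq) τ =
    SumsTo-resp split (trans (sym (distribʳ _ _ _)) (*-congʳ (sym eq)))
      (SumsTo-+ (SumsTo-· (f 0) τ) shifted)
    where
    -- Multiplication by the variable, which does not change the value at 1. It occurs because `f`
    -- is `f 0` plus the variable times its tail.
    shift : Series → Series
    shift h zero    = 0#
    shift h (suc n) = h n

    shifted : shift ((f ∘ suc) *ˢ g) SumsTo (u * w)
    shifted = cons (SumsTo-* σ τ) (sym (+-identityˡ _))

    split : f 0 · g +ˢ shift ((f ∘ suc) *ˢ g) ≋ f *ˢ g
    split zero    = +-identityʳ _
    split (suc n) = refl

  -- The lowest coefficients of `x` are killed by the constant term of `M`, so they vanish. Then `x`
  -- is divisible by the variable, and the quotient satisfies the same equations.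
  injective-from-constant-term : ∀ {i} {I : Set i} {m} (M : I → Fin m → Series) →
    Injective (λ i j → M i j 0) → (x : Fin m → Series) →
    (∀ i n → sum (λ j → (x j *ˢ M i j) n) ≈ 0#) → ∀ n j → x j n ≈ 0#
  injective-from-constant-term M inj x Mx≈0 zero    = inj (λ j → x j 0) (λ i → Mx≈0 i 0)
  injective-from-constant-term M inj x Mx≈0 (suc n) =
    injective-from-constant-term M inj (λ j → x j ∘ suc) Mx′≈0 n
    where
    Mx′≈0 : ∀ i n → sum (λ j → ((x j ∘ suc) *ˢ M i j) n) ≈ 0#
    Mx′≈0 i n = trans (sum-cong-≋ λ j → begin
      ((x j ∘ suc) *ˢ M i j) n
        ≈⟨ +-identityˡ _ ⟨
      0# + ((x j ∘ suc) *ˢ M i j) n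
        ≈⟨ +-congʳ (zeroˡ _) ⟨
      0# * M i j (suc n) + ((x j ∘ suc) *ˢ M i j) n
        ≈⟨ +-congʳ (*-congʳ (injective-from-constant-term M inj x Mx≈0 zero j)) ⟨
      (x j *ˢ M i j) (suc n) ∎) (Mx≈0 i (suc n))

module Evaluation {c ℓ c′ ℓ′} (R : CommutativeRing c ℓ) (X : Set) (A : CommutativeRing c′ ℓ′) where
  private
    module R = CommutativeRing R
    module A = CommutativeRing A
  open Polynomials R X

  module At
    (ι : R.Carrier → A.Carrier)
    (ι-cong : ∀ {a b} → a R.≈ b → ι a A.≈ ι b)
    (ι-+ : ∀ a b → ι (a R.+ b) A.≈ ι a A.+ ι b)
    (ι-* : ∀ a b → ι (a R.* b) A.≈ ι a A.* ι b)
    (ι-0 : ι R.0# A.≈ A.0#)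
    (ι-1 : ι R.1# A.≈ A.1#)
    (point : X → A.Carrier)
    where

    eval : Polynomial → A.Carrier
    eval (con a) = ι a
    eval (var x) = point x
    eval (p ⊕ q) = eval p A.+ eval q
    eval (p ⊗ q) = eval p A.* eval q
    eval (⊖ p)   = A.- eval p

    eval-cong : ∀ {p q} → p ≈ₚ q → eval p A.≈ eval q
    eval-cong reflₚ             = A.refl
    eval-cong (symₚ e)          = A.sym (eval-cong e)
    eval-cong (transₚ e e′)     = A.trans (eval-cong e) (eval-cong e′)
    eval-cong (con-cong a≈b)    = ι-cong a≈b
    eval-cong (⊕-cong e e′)     = A.+-cong (eval-cong e) (eval-cong e′)
    eval-cong (⊗-cong e e′)     = A.*-cong (eval-cong e) (eval-cong e′)
    eval-cong (⊖-cong e)        = A.-‿cong (eval-cong e)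
    eval-cong (con-⊕ a b)       = ι-+ a b
    eval-cong (con-⊗ a b)       = ι-* a b
    eval-cong (⊕-assoc p q r)   = A.+-assoc _ _ _
    eval-cong (⊕-comm p q)      = A.+-comm _ _
    eval-cong (⊕-identityˡ p)   = A.trans (A.+-congʳ ι-0) (A.+-identityˡ _)
    eval-cong (⊖-inverseˡ p)    = A.trans (A.-‿inverseˡ _) (A.sym ι-0)
    eval-cong (⊗-assoc p q r)   = A.*-assoc _ _ _
    eval-cong (⊗-comm p q)      = A.*-comm _ _
    eval-cong (⊗-identityˡ p)   = A.trans (A.*-congʳ ι-1) (A.*-identityˡ _)
    eval-cong (⊗-distribˡ p q r) = A.distribˡ _ _ _

-- Along x ↦ x₀ + t (x − x₀) a polynomial p becomes a polynomial in t with
-- constant term p(x₀) and value p at t = 1.  A vector in the kernel of M has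
-- all its t-coefficients in the kernel of M(x₀), lowest order first.

module Specialization {c ℓ} (R : CommutativeRing c ℓ) (X : Set)
  (point : X → Polynomials.Polynomial R X) where
  open Polynomials R X
  open CommutativeRing polynomialRing hiding (zero)
  open PowerSeries polynomialRing
  open Sums polynomialRing

  line : X → Series
  line x zero          = point x
  line x (suc zero)    = var x - point x
  line x (suc (suc _)) = 0#

  const-cong : ∀ {p q} → p ≈ q → const p ≋ const q
  const-cong p≈q zero    = p≈q
  const-cong p≈q (suc _) = refl

  const-+ : ∀ a b → const (con a ⊕ con b) ≋ const (con a) +ˢ const (con b)
  const-+ a b zero    = refl
  const-+ a b (suc _) = sym (+-identityˡ 0#)

  const-* : ∀ a b → const (con a ⊗ con b) ≋ const (con a) *ˢ const (con b)
  const-* a b n = trans (scaled n) (sym (const-*ˢ (con a) (const (con b)) n))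
    where
    scaled : const (con a ⊗ con b) ≋ con a · const (con b)
    scaled zero    = refl
    scaled (suc _) = sym (zeroʳ _)

  private
    module E = Evaluation R X powerSeriesRing

  open E.At (λ a → const (con a))
    (λ a≈b → const-cong (con-cong a≈b))
    (λ a b n → trans (const-cong (con-⊕ a b) n) (const-+ a b n))
    (λ a b n → trans (const-cong (con-⊗ a b) n) (const-* a b n))
    (λ _ → refl) (λ _ → refl) line
    public renaming (eval to expand; eval-cong to expand-cong)

  expand-SumsTo : ∀ p → expand p SumsTo p
  expand-SumsTo (con a) = SumsTo-const (con a)
  expand-SumsTo (var x) =
    cons (cons (nil (λ _ → refl) refl) (sym (+-identityʳ _))) (sym cancel)
    where
    cancel : point x + (var x - point x) ≈ var x
    cancel = trans (+-comm _ _) (trans (+-assoc _ _ _)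
      (trans (+-congˡ (-‿inverseˡ _)) (+-identityʳ _)))
  expand-SumsTo (p ⊕ q) = SumsTo-+ (expand-SumsTo p) (expand-SumsTo q)
  expand-SumsTo (p ⊗ q) = SumsTo-* (expand-SumsTo p) (expand-SumsTo q)
  expand-SumsTo (⊖ p)   = SumsTo-neg (expand-SumsTo p)

  -- The constant term along the line, hence the value at `point`.
  specialize : Polynomial → Polynomial
  specialize p = expand p 0

  specialize-injective : ∀ {i} {I : Set i} {m} (M : I → Fin m → Polynomial) →
    Injective (λ i j → specialize (M i j)) → Injective M
  -- `x j` is the value at t = 1 of its own expansion, all of whose coefficients vanish.
  specialize-injective M inj x Mx≈0 j = SumsTo-zero (expand-SumsTo (x j)) λ n →
    injective-from-constant-term (λ i j → expand (M i j)) inj (expand ∘ x)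
      (λ i n → trans (sym (expand-sum (λ j → x j) (M i) n))
        (trans (expand-cong (Mx≈0 i) n) (const0 n)))
      n j
    where
    expand-sum : ∀ {m} (f g : Fin m → Polynomial) n →
      expand (sum (λ j → f j ⊗ g j)) n ≈ sum (λ j → (expand (f j) *ˢ expand (g j)) n)
    expand-sum {zero}  f g n = const0 n
    expand-sum {suc m} f g n = +-congˡ (expand-sum (f ∘ suc) (g ∘ suc) n)

-- Clearing denominators

module FractionIndependence {c ℓ} (R : CommutativeRing c ℓ) where
  open CommutativeRing R hiding (zero; rawRing)
  open Fractions R
  open LinearAlgebra fractionRing using (LinearlyIndependent)
  open Sums R
  open SetoidReasoning setoid
  open CommutativeSemigroupProperties *-commutativeSemigroup using (xy∙z≈xz∙y)
  open Fraction
  private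
    module F = RawRing fractionRing
    sumF : ∀ {m} → (Fin m → Fraction) → Fraction
    sumF = RawMonoidDefs.sum F.+-rawMonoid

  -- Addition of fractions multiplies denominators without reducing. Hence `common` is the product
  -- of all denominators, whatever the vector `v`, and `factor k` is the product of the others.
  record ClearedDenominators {m} (a : Fin m → Fraction) : Set (c ⊔ ℓ) where
    field
      factor   : Fin m → Carrier
      factor-regular : ∀ k → Regular (factor k)
      common   : Carrier
      factor-den : ∀ k → factor k * den (a k) ≈ common
      num-sum  : ∀ (v : Fin m → Carrier) →
        num (sumF (λ k → a k F.* fromRing (v k))) ≈ sum (λ k → factor k * num (a k) * v k)
      den-sum  : ∀ (v : Fin m → Carrier) → den (sumF (λ k → a k F.* fromRing (v k))) ≈ common

  clear : ∀ {m} (a : Fin m → Fraction) → ClearedDenominators a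
  clear {zero} a = record
    { factor = λ () ; factor-regular = λ () ; common = 1# ; factor-den = λ ()
    ; num-sum = λ _ → refl ; den-sum = λ _ → refl }
  clear {suc m} a = record
    { factor = factor′
    ; factor-regular = λ where
        zero    → restden-regular
        (suc k) → *-regular (factor-regular k) (*-regular (regular (a zero)) 1-regular)
    ; common = d₀ * restden
    ; factor-den = λ where
        zero    → trans (*-comm _ _) (*-congʳ (sym (*-identityʳ _)))
        (suc k) → trans (xy∙z≈xz∙y _ _ _) (trans (*-congʳ (trans (factor-den k) (sym (den-sum (λ _ → 0#))))) (*-comm _ _))
    ; num-sum = λ v → begin
        num (a zero) * v zero * den (rest v) + num (rest v) * d₀
          ≈⟨ +-cong (trans (*-comm _ _) (trans (*-congʳ (restden≈ v)) (sym (*-assoc _ _ _))))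
               (trans (*-congʳ (num-sum (v ∘ suc))) (*-distribʳ-sum d₀ (λ k → factor k * num (a (suc k)) * v (suc k)))) ⟩
        restden * num (a zero) * v zero + sum (λ k → factor k * num (a (suc k)) * v (suc k) * d₀)
          ≈⟨ +-congˡ (sum-cong-≋ {m} λ k → trans (xy∙z≈xz∙y _ _ _) (*-congʳ (xy∙z≈xz∙y _ _ _))) ⟩
        restden * num (a zero) * v zero + sum (λ k → factor k * d₀ * num (a (suc k)) * v (suc k)) ∎
    ; den-sum = λ v → *-congˡ (restden≈ v)
    }
    where
    open ClearedDenominators (clear (a ∘ suc))
    d₀ : Carrier
    d₀ = den (a zero) * 1#
    rest : (Fin (suc m) → Carrier) → Fraction
    rest v = sumF (λ k → a (suc k) F.* fromRing (v (suc k)))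
    -- The denominator is the same for every `v` up to equality; the zero vector supplies one
    -- representative together with its regularity proof.
    restden : Carrier
    restden = den (rest (λ _ → 0#))
    restden-regular : Regular restden
    restden-regular = regular (rest (λ _ → 0#))
    restden≈ : ∀ v → den (rest v) ≈ restden
    restden≈ v = trans (den-sum (v ∘ suc)) (sym (den-sum (λ _ → 0#)))
    factor′ : Fin (suc m) → Carrier
    factor′ zero    = restden
    factor′ (suc k) = factor k * d₀

  independent⇒injective : ∀ {I : Set} {m} (M : I → Fin m → Carrier) →
    LinearlyIndependent (λ k θ → fromRing (M θ k)) → Injective M
  independent⇒injective M indep x Mx≈0 k = trans (sym (*-identityʳ _))
    (trans (indep (fromRing ∘ x) sum≈0 k) (zeroˡ _))
    where
    open ClearedDenominators (clear (fromRing ∘ x))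
    -- All denominators are `1#` here, so every factor is the full product and can be pulled out of
    -- the sum.
    factor≈common : ∀ k → factor k ≈ common
    factor≈common k = trans (sym (*-identityʳ _)) (factor-den k)
    sum≈0 : ∀ θ → sumF (λ k → fromRing (x k) F.* fromRing (M θ k)) F.≈ F.0#
    sum≈0 θ = begin
      num (sumF (λ k → fromRing (x k) F.* fromRing (M θ k))) * 1#  ≈⟨ *-identityʳ _ ⟩
      num (sumF (λ k → fromRing (x k) F.* fromRing (M θ k)))       ≈⟨ num-sum (M θ) ⟩
      sum (λ k → factor k * x k * M θ k)                           ≈⟨ sum-cong-≋ (λ k → trans (*-congʳ (*-congʳ (factor≈common k))) (*-assoc _ _ _)) ⟩
      sum (λ k → common * (x k * M θ k))                           ≈⟨ *-distribˡ-sum common (λ k → x k * M θ k) ⟨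
      common * sum (λ k → x k * M θ k)                             ≈⟨ *-congˡ (Mx≈0 θ) ⟩
      common * 0#                                                  ≈⟨ zeroʳ _ ⟩
      0#                                                           ≈⟨ zeroˡ _ ⟨
      0# * den (sumF (λ k → fromRing (x k) F.* fromRing (M θ k)))  ∎

  injective⇒independent : ∀ {I : Set} {m} (M : I → Fin m → Carrier) →
    Injective M → LinearlyIndependent (λ k θ → fromRing (M θ k))
  injective⇒independent M inj a sum≈0 k = begin
    num (a k) * 1#    ≈⟨ *-identityʳ _ ⟩
    num (a k)         ≈⟨ factor-regular k (num (a k)) (inj (λ k → factor k * num (a k)) numerators k) ⟩
    0#                ≈⟨ zeroˡ _ ⟨
    0# * den (a k)    ∎
    where
    open ClearedDenominators (clear a)
    numerators : ∀ θ → sum (λ k → factor k * num (a k) * M θ k) ≈ 0#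
    numerators θ = begin
      sum (λ k → factor k * num (a k) * M θ k)           ≈⟨ num-sum (M θ) ⟨
      num (sumF (λ k → a k F.* fromRing (M θ k)))        ≈⟨ *-identityʳ _ ⟨
      num (sumF (λ k → a k F.* fromRing (M θ k))) * 1#   ≈⟨ sum≈0 θ ⟩
      0# * den (sumF (λ k → a k F.* fromRing (M θ k)))   ≈⟨ zeroˡ _ ⟩
      0#                                                 ∎

-- The Jacobian

module Triangular {c ℓ} (A : CommutativeRing c ℓ) where
  open CommutativeRing A hiding (zero)
  open Sums A

  Cancellable : Carrier → Set (c ⊔ ℓ)
  Cancellable u = ∀ x → x * u ≈ 0# → x ≈ 0#

  -- The equation of `row j` involves, apart from `x j`, only unknowns of strictly smaller rank, so
  -- strong induction on the rank solves for `x j`. Several columns may share a rank: the diagonal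
  -- blocks are themselves diagonal.
  triangular-injective : ∀ {i} {I : Set i} {m} (M : I → Fin m → Carrier)
    (row : Fin m → I) (rank : Fin m → ℕ) →
    (∀ j → Cancellable (M (row j) j)) →
    (∀ {j k} → j ≢ k → rank j ℕ.≤ rank k → M (row j) k ≈ 0#) →
    Injective M
  triangular-injective M row rank diagonal above x Mx≈0 j = below (suc (rank j)) j ℕ.≤-refl
    where
    below : ∀ N j → rank j ℕ.< N → x j ≈ 0#
    below (suc N) j (s≤s rj≤N) = diagonal j (x j)
      (trans (sym (sum-single (λ k → x k * M (row j) k) j others)) (Mx≈0 (row j)))
      where
      others : ∀ k → k ≢ j → x k * M (row j) k ≈ 0#
      others k k≢j with rank j ℕ.≤? rank k
      ... | yes rj≤rk = trans (*-congˡ (above (k≢j ∘ ≡.sym) rj≤rk)) (zeroʳ _)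
      ... | no rj≰rk  = trans (*-congʳ (below N k (ℕ.<-≤-trans (ℕ.≰⇒> rj≰rk) rj≤N))) (zeroˡ _)

lookup-injective : ∀ {a} {A : Set a} {xs : List A} → Unique xs →
  ∀ {i j} → lookup xs i ≡ lookup xs j → i ≡ j
lookup-injective (_  ∷ _) {zero}  {zero}  _  = ≡.refl
lookup-injective (x∉ ∷ _) {zero}  {suc j} eq = contradiction eq (All.lookup x∉ (∈-lookup j))
lookup-injective (x∉ ∷ _) {suc i} {zero}  eq = contradiction (≡.sym eq) (All.lookup x∉ (∈-lookup i))
lookup-injective (_  ∷ u) {suc i} {suc j} eq = ≡.cong suc (lookup-injective u eq)

-- Treats a column as an unordered pair, so that edges need not be compared with the order of the
-- nodes. For `k ≡ l` both constructors apply.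
data Joins {n} (k l : Fin n) : Column n → Set where
  forward  : .(k≤l : k Fin.≤ l) → Joins k l (column k l k≤l)
  backward : .(l≤k : l Fin.≤ k) → Joins k l (column l k l≤k)

pairColumn : ∀ {n} → Fin n → Fin n → Column n
pairColumn k l with k Fin.≤? l
... | yes k≤l = column k l k≤l
... | no k≰l  = column l k (ℕ.<⇒≤ (ℕ.≰⇒> k≰l))

joins-pairColumn : ∀ {n} (k l : Fin n) → Joins k l (pairColumn k l)
joins-pairColumn k l with k Fin.≤? l
... | yes _ = forward _
... | no _  = backward _

pairColumn-joins : ∀ {n} {k l : Fin n} {c} → Joins k l c → c ≡ pairColumn k l
pairColumn-joins {k = k} {l} (forward k≤l) with k Fin.≤? l
... | yes _  = ≡.refl
... | no k≰l = contradiction (recompute (k Fin.≤? l) k≤l) k≰l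
pairColumn-joins {k = k} {l} (backward l≤k) with k Fin.≤? l
... | no _    = ≡.refl
... | yes k≤l with Fin.≤-antisym k≤l (recompute (l Fin.≤? k) l≤k)
...   | ≡.refl = ≡.refl

joins-unique : ∀ {n} {k l : Fin n} {c d} → Joins k l c → Joins k l d → c ≡ d
joins-unique c d = ≡.trans (pairColumn-joins c) (≡.sym (pairColumn-joins d))

joins-endpoints : ∀ {n} {k l k′ l′ : Fin n} {c} → Joins k l c → Joins k′ l′ c →
  (k ≡ k′ × l ≡ l′) ⊎ (k ≡ l′ × l ≡ k′)
joins-endpoints (forward _)  (forward _)  = inj₁ (≡.refl , ≡.refl)
joins-endpoints (forward _)  (backward _) = inj₂ (≡.refl , ≡.refl)
joins-endpoints (backward _) (forward _)  = inj₂ (≡.refl , ≡.refl)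
joins-endpoints (backward _) (backward _) = inj₁ (≡.refl , ≡.refl)

joins-diagonal : ∀ {n} {k l m : Fin n} {c} → Joins k l c → Joins m m c → k ≡ l
joins-diagonal kl mm with joins-endpoints kl mm
... | inj₁ (≡.refl , ≡.refl) = ≡.refl
... | inj₂ (≡.refl , ≡.refl) = ≡.refl

module Jacobian {n} (G : Digraph n) where
  open Digraph G public using (_⟶_; Adjacent; loopless; D)
  open PrecisionParameterization G public
  open CommutativeRing polynomialRing public hiding (zero)
  open Sums polynomialRing public
  open Triangular polynomialRing public
  open SetoidReasoning setoid
  open RingProperties ring public using (-0#≈0#; -‿distribˡ-*; -‿distribʳ-*; -‿+-comm)

  δ : Fin n → Fin n → Polynomial
  δ i j = if does (i Fin.≟ j) then 1ₚ else 0ₚ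

  δ-refl : ∀ i → δ i i ≡ 1ₚ
  δ-refl i = ≡.cong (if_then 1ₚ else 0ₚ) (dec-true (i Fin.≟ i) ≡.refl)

  δ-≢ : ∀ {i j} → i ≢ j → δ i j ≡ 0ₚ
  δ-≢ {i} {j} i≢j = ≡.cong (if_then 1ₚ else 0ₚ) (dec-false (i Fin.≟ j) i≢j)

  ∂-δ : ∀ θ i j → ∂ θ (δ i j) ≡ 0ₚ
  ∂-δ θ i j with does (i Fin.≟ j)
  ... | true  = ≡.refl
  ... | false = ≡.refl

  ∂-sum : ∀ θ {m} (f : Fin m → Polynomial) → ∂ θ (sum f) ≡ sum (∂ θ ∘ f)
  ∂-sum θ {zero}  f = ≡.refl
  ∂-sum θ {suc m} f = ≡.cong (∂ θ (f zero) ⊕_) (∂-sum θ (f ∘ suc))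

  ∂s-Λ : ∀ i j → ∂ s (Λ i j) ≡ 0ₚ
  ∂s-Λ i j with T? (D i j)
  ... | yes _ = ≡.refl
  ... | no _  = ≡.refl

  ∂λ-Λ : ∀ {k l} (e : k ⟶ l) i j → ∂ λ[ e ] (Λ i j) ≈ δ k i * δ l j
  ∂λ-Λ {k} {l} e i j with T? (D i j)
  ... | yes e′ with k Fin.≟ i | l Fin.≟ j
  ...   | yes ≡.refl | yes ≡.refl = sym (*-identityˡ 1ₚ)
  ...   | yes ≡.refl | no _       = sym (zeroʳ _)
  ...   | no _       | _          = sym (zeroˡ _)
  ∂λ-Λ {k} {l} e i j | no ¬e with k Fin.≟ i | l Fin.≟ j
  ...   | yes ≡.refl | yes ≡.refl = contradiction e ¬e
  ...   | yes ≡.refl | no _       = sym (zeroʳ _)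
  ...   | no _       | _          = sym (zeroˡ _)

  ∂s-I-Λ : ∀ i j → ∂ s (I-Λ i j) ≈ 0ₚ
  ∂s-I-Λ i j = trans (+-cong (reflexive (∂-δ s i j)) (-‿cong (reflexive (∂s-Λ i j))))
                     (-‿inverseʳ 0ₚ)

  ∂λ-I-Λ : ∀ {k l} (e : k ⟶ l) i j → ∂ λ[ e ] (I-Λ i j) ≈ - (δ k i * δ l j)
  ∂λ-I-Λ e i j = trans (+-cong (reflexive (∂-δ λ[ e ] i j)) (-‿cong (∂λ-Λ e i j))) (+-identityˡ _)

  ∂s-ψ : ∀ p q → ∂ s (ψ p q) ≈ sum (λ m → I-Λ p m * I-Λ q m)
  ∂s-ψ p q = begin
    1ₚ * r·r + var s * ∂ s r·r  ≈⟨ +-cong (*-identityˡ _) (*-congˡ vanish) ⟩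
    r·r + var s * 0ₚ            ≈⟨ +-congˡ (zeroʳ _) ⟩
    r·r + 0ₚ                    ≈⟨ +-identityʳ _ ⟩
    r·r                         ∎
    where
    r·r : Polynomial
    r·r = sum (λ m → I-Λ p m * I-Λ q m)
    vanish : ∂ s r·r ≈ 0ₚ
    vanish = trans (reflexive (∂-sum s (λ m → I-Λ p m * I-Λ q m))) (sum-zero λ m →
      trans (+-cong (trans (*-congʳ (∂s-I-Λ p m)) (zeroˡ _)) (trans (*-congˡ (∂s-I-Λ q m)) (zeroʳ _)))
            (+-identityˡ 0ₚ))

  -- Of the scalar product of rows p and q of I - Λ, only the summand m = l can contain λ_{kl}; the
  -- Leibniz rule then gives one term for each of the two rows.
  ∂λ-ψ : ∀ {k l} (e : k ⟶ l) p q →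
    ∂ λ[ e ] (ψ p q) ≈ var s * - (δ k p * I-Λ q l + δ k q * I-Λ p l)
  ∂λ-ψ {k} {l} e p q = begin
    0ₚ * r·r + var s * ∂ λ[ e ] r·r                    ≈⟨ +-cong (zeroˡ _) (*-congˡ row) ⟩
    0ₚ + var s * - (δ k p * I-Λ q l + δ k q * I-Λ p l)  ≈⟨ +-identityˡ _ ⟩
    var s * - (δ k p * I-Λ q l + δ k q * I-Λ p l)       ∎
    where
    r·r : Polynomial
    r·r = sum (λ m → I-Λ p m * I-Λ q m)
    term : Fin n → Polynomial
    term m = ∂ λ[ e ] (I-Λ p m) * I-Λ q m + I-Λ p m * ∂ λ[ e ] (I-Λ q m)
    ∂-off : ∀ i m → m ≢ l → ∂ λ[ e ] (I-Λ i m) ≈ 0ₚ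
    ∂-off i m m≢l = begin
      ∂ λ[ e ] (I-Λ i m)   ≈⟨ ∂λ-I-Λ e i m ⟩
      - (δ k i * δ l m)    ≈⟨ -‿cong (*-congˡ (reflexive (δ-≢ (m≢l ∘ ≡.sym)))) ⟩
      - (δ k i * 0ₚ)       ≈⟨ -‿cong (zeroʳ _) ⟩
      - 0ₚ                 ≈⟨ -0#≈0# ⟩
      0ₚ                   ∎
    ∂-on : ∀ i → ∂ λ[ e ] (I-Λ i l) ≈ - δ k i
    ∂-on i = trans (∂λ-I-Λ e i l)
      (-‿cong (trans (*-congˡ (reflexive (δ-refl l))) (*-identityʳ _)))
    row : ∂ λ[ e ] r·r ≈ - (δ k p * I-Λ q l + δ k q * I-Λ p l)
    row = begin
      ∂ λ[ e ] r·r                               ≈⟨ reflexive (∂-sum λ[ e ] (λ m → I-Λ p m * I-Λ q m)) ⟩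
      sum term                                   ≈⟨ sum-single term l (λ m m≢l → trans
                                                      (+-cong (trans (*-congʳ (∂-off p m m≢l)) (zeroˡ _))
                                                              (trans (*-congˡ (∂-off q m m≢l)) (zeroʳ _)))
                                                      (+-identityˡ 0ₚ)) ⟩
      term l                                     ≈⟨ +-cong (*-congʳ (∂-on p)) (trans (*-congˡ (∂-on q)) (*-comm _ _)) ⟩
      - δ k p * I-Λ q l + - δ k q * I-Λ p l      ≈⟨ +-cong (-‿distribˡ-* _ _) (-‿distribˡ-* _ _) ⟨
      - (δ k p * I-Λ q l) + - (δ k q * I-Λ p l)  ≈⟨ -‿+-comm _ _ ⟩
      - (δ k p * I-Λ q l + δ k q * I-Λ p l)      ∎

  entry : Parameter → Column n → Polynomial
  entry θ c = ∂ θ (ψ (Column.row c) (Column.col c))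

  independent⇒kernel-trivial : ∀ {S} → Independent G S →
    Injective (λ θ k → entry θ (lookup S k))
  independent⇒kernel-trivial = FractionIndependence.independent⇒injective polynomialRing _

  kernel-trivial⇒independent : ∀ {S} → Injective (λ θ k → entry θ (lookup S k)) →
    Independent G S
  kernel-trivial⇒independent = FractionIndependence.injective⇒independent polynomialRing _

  -- Evaluation at the origin would make the reals 1 and 0 equal, which already fails for ε = 1.
  1≉0 : ¬ 1ₚ ≈ 0ₚ
  1≉0 1≈0 with E.eval-cong 1≈0 1ℚ (ℚ.positive⁻¹ 1ℚ)
    where
    module Rℝ = CommutativeRing ℝ-commutativeRing
    module V = Evaluation ℝ-commutativeRing Parameter ℝ-commutativeRing
    module E = V.At id id
      (λ a b → Rℝ.refl {a +ᴿ b}) (λ a b → Rℝ.refl {a *ᴿ b})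
      (Rℝ.refl {Rℝ.0#}) (Rℝ.refl {Rℝ.1#}) (λ _ → Rℝ.0#)
  ... | N , close = ℚ.<-irrefl ≡.refl (close N ℕ.≤-refl)

  -- Rows outside `R` vanish on `S`, so the finite matrix with rows `R` already has trivial kernel
  -- and the bound by the number of rows applies.
  independent⇒length≤ : ∀ {S} → Independent G S → (R : List Parameter) →
    (∀ θ → θ ∈ R ⊎ (∀ k → entry θ (lookup S k) ≈ 0ₚ)) → length S ℕ.≤ length R
  independent⇒length≤ {S} indep R cover =
    injective⇒≤ polynomialRing 1≉0 (λ i k → entry (lookup R i) (lookup S k)) λ x Rx≈0 →
      independent⇒kernel-trivial {S} indep x λ θ → row x Rx≈0 θ (cover θ)
    where
    row : ∀ x → (∀ i → sum (λ k → x k * entry (lookup R i) (lookup S k)) ≈ 0ₚ) → ∀ θ →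
      θ ∈ R ⊎ (∀ k → entry θ (lookup S k) ≈ 0ₚ) → sum (λ k → x k * entry θ (lookup S k)) ≈ 0ₚ
    row x Rx≈0 θ (inj₁ θ∈R) =
      ≡.subst (λ θ → sum (λ k → x k * entry θ (lookup S k)) ≈ 0ₚ)
        (≡.sym (lookup-index θ∈R)) (Rx≈0 (index θ∈R))
    row x Rx≈0 θ (inj₂ θS≈0) = sum-zero λ k → trans (*-congˡ (θS≈0 k)) (zeroʳ _)

  -- K_{pq} is `s` times the product of rows p and q of I - Λ, and λ_{kl} occurs in row k only.
  entry-zero : ∀ {k l} (e : k ⟶ l) c → Column.row c ≢ k → Column.col c ≢ k → entry λ[ e ] c ≈ 0ₚ
  entry-zero {k} {l} e (column p q _) p≢k q≢k = begin
    ∂ λ[ e ] (ψ p q)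
      ≈⟨ ∂λ-ψ e p q ⟩
    var s * - (δ k p * I-Λ q l + δ k q * I-Λ p l)
      ≈⟨ *-congˡ (-‿cong (+-cong (*-congʳ (reflexive (δ-≢ (p≢k ∘ ≡.sym)))) (*-congʳ (reflexive (δ-≢ (q≢k ∘ ≡.sym)))))) ⟩
    var s * - (0ₚ * I-Λ q l + 0ₚ * I-Λ p l)
      ≈⟨ *-congˡ (-‿cong (trans (+-cong (zeroˡ _) (zeroˡ _)) (+-identityˡ 0ₚ))) ⟩
    var s * - 0ₚ
      ≈⟨ trans (*-congˡ -0#≈0#) (zeroʳ _) ⟩
    0ₚ ∎

-- Fits matches parameters with columns.  At λ_{kl} = v k l, s = 1 the entries are
-- ∂K_{pq}/∂λ_{kl} = − (δ_{kp} r_{ql} + δ_{kq} r_{pl}), where r = I − Λ, and the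
-- matched square submatrix is triangular with respect to rank.

module Matching {n} (G : Digraph n) (v : Fin n → Fin n → Bool) (i a b : Fin n) where
  open Jacobian G
  open SetoidReasoning setoid

  -- At the chosen point the matched entries are -r_{ll} = -1 for `edge`, -r_{ai} = 1 for `pair`, -2
  -- r_{ki} = 2 for `loop`, and the squared length 1 of row b of r for `base`.
  data Fits : Parameter → Column n → Set where
    edge : ∀ {k l c} (e : k ⟶ l) → (∀ q → v q l ≡ false) → Joins k l c → Fits λ[ e ] c
    pair : ∀ {c} (e : b ⟶ i) → v b i ≡ false → a ⟶ i → v a i ≡ true → ¬ Adjacent a b →
           Joins a b c → Fits λ[ e ] c
    loop : ∀ {k c} (e : k ⟶ i) → v k i ≡ true → Joins k k c → Fits λ[ e ] c
    base : ∀ {c} → (∀ m → v b m ≡ false) → Joins b b c → Fits s c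

  rank : ∀ {θ c} → Fits θ c → ℕ
  rank (edge _ _ _)         = 0
  rank (pair _ _ _ _ _ _)   = 1
  rank (loop _ _ _)         = 2
  rank (base _ _)           = 3

  point : Parameter → Polynomial
  point (λ[_] {k} {l} _) = if v k l then 1ₚ else 0ₚ
  point s                = 1ₚ

  open Specialization ℝ-commutativeRing Parameter point
    using (specialize; specialize-injective; expand-cong)

  specialize-cong : ∀ {p q} → p ≈ q → specialize p ≈ specialize q
  specialize-cong p≈q = expand-cong p≈q 0

  specialize-δ : ∀ k l → specialize (δ k l) ≡ δ k l
  specialize-δ k l with does (k Fin.≟ l)
  ... | true  = ≡.refl
  ... | false = ≡.refl

  specialize-sum : ∀ {m} (f : Fin m → Polynomial) → specialize (sum f) ≡ sum (specialize ∘ f)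
  specialize-sum {zero}  f = ≡.refl
  specialize-sum {suc m} f = ≡.cong (specialize (f zero) ⊕_) (specialize-sum (f ∘ suc))

  r : Fin n → Fin n → Polynomial
  r k l = specialize (I-Λ k l)

  specialize-Λ-false : ∀ {k l} → v k l ≡ false → specialize (Λ k l) ≡ 0ₚ
  specialize-Λ-false {k} {l} vkl with T? (D k l)
  ... | yes _ rewrite vkl = ≡.refl
  ... | no _  = ≡.refl

  specialize-Λ-true : ∀ {k l} → k ⟶ l → v k l ≡ true → specialize (Λ k l) ≡ 1ₚ
  specialize-Λ-true {k} {l} e vkl with T? (D k l)
  ... | yes _ rewrite vkl = ≡.refl
  ... | no ¬e = contradiction e ¬e

  r-false : ∀ {k l} → v k l ≡ false → r k l ≈ δ k l
  r-false {k} {l} vkl = begin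
    specialize (δ k l) - specialize (Λ k l)  ≈⟨ +-cong (reflexive (specialize-δ k l))
                                                  (-‿cong (reflexive (specialize-Λ-false vkl))) ⟩
    δ k l - 0ₚ                               ≈⟨ +-congˡ -0#≈0# ⟩
    δ k l + 0ₚ                               ≈⟨ +-identityʳ _ ⟩
    δ k l                                    ∎

  ⟶⇒≢ : ∀ {k l} → k ⟶ l → k ≢ l
  ⟶⇒≢ e ≡.refl = loopless _ e

  r-true : ∀ {k l} → k ⟶ l → v k l ≡ true → r k l ≈ - 1ₚ
  r-true {k} {l} e vkl = begin
    specialize (δ k l) - specialize (Λ k l)  ≈⟨ +-cong (reflexive (specialize-δ k l))
                                                  (-‿cong (reflexive (specialize-Λ-true e vkl))) ⟩
    δ k l - 1ₚ                               ≈⟨ +-congʳ (reflexive (δ-≢ (⟶⇒≢ e))) ⟩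
    0ₚ - 1ₚ                                  ≈⟨ +-identityˡ _ ⟩
    - 1ₚ                                     ∎

  entryλ : ∀ {k l} → Fin n → Fin n → k ⟶ l → Polynomial
  entryλ {k} {l} p q _ = - (δ k p * r q l + δ k q * r p l)

  specialize-entryλ : ∀ {k l p q c} (e : k ⟶ l) → Joins p q c →
    specialize (entry λ[ e ] c) ≈ entryλ p q e
  specialize-entryλ {k} {l} {p} {q} e (forward _) = begin
    specialize (∂ λ[ e ] (ψ p q))
      ≈⟨ specialize-cong (∂λ-ψ e p q) ⟩
    1ₚ * - (specialize (δ k p) * r q l + specialize (δ k q) * r p l)
      ≈⟨ *-identityˡ _ ⟩
    - (specialize (δ k p) * r q l + specialize (δ k q) * r p l)
      ≈⟨ -‿cong (+-cong (*-congʳ (reflexive (specialize-δ k p))) (*-congʳ (reflexive (specialize-δ k q)))) ⟩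
    - (δ k p * r q l + δ k q * r p l) ∎
  specialize-entryλ {k} {l} {p} {q} e (backward q≤p) =
    trans (specialize-entryλ e (forward q≤p)) (-‿cong (+-comm _ _))

  entryλ-zero : ∀ {k l p q} (e : k ⟶ l) →
    (k ≡ p → r q l ≈ 0ₚ) → (k ≡ q → r p l ≈ 0ₚ) → entryλ p q e ≈ 0ₚ
  entryλ-zero {k} {l} {p} {q} e rq≈0 rp≈0 =
    trans (-‿cong (trans (+-cong (term rq≈0) (term rp≈0)) (+-identityˡ 0ₚ))) -0#≈0#
    where
    term : ∀ {x y} → (k ≡ x → r y l ≈ 0ₚ) → δ k x * r y l ≈ 0ₚ
    term {x} r≈0 with k Fin.≟ x
    ... | yes k≡x = trans (*-congˡ (r≈0 k≡x)) (zeroʳ _)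
    ... | no  _   = zeroˡ _

  entryλ-off : ∀ {k l p q} (e : k ⟶ l) → k ≢ p → k ≢ q → entryλ p q e ≈ 0ₚ
  entryλ-off e k≢p k≢q =
    entryλ-zero e (λ k≡p → contradiction k≡p k≢p) (λ k≡q → contradiction k≡q k≢q)

  true≢false : true ≢ false
  true≢false ()

  v-≢ : ∀ {k l m} → v k m ≡ true → v l m ≡ false → k ≢ l
  v-≢ vk vl ≡.refl = true≢false (≡.trans (≡.sym vk) vl)

  column-joins : ∀ (c : Column n) → Joins (Column.row c) (Column.col c) c
  column-joins (column _ _ p≤q) = forward p≤q

  joins-≢ : ∀ {k l p q} {c c′ : Column n} → Joins k l c → Joins p q c′ → c ≢ c′ → k ≡ p → q ≢ l
  joins-≢ kl pq c≢c′ ≡.refl ≡.refl = c≢c′ (joins-unique kl pq)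

  joins-sym : ∀ {k l} {c : Column n} → Joins k l c → Joins l k c
  joins-sym (forward k≤l)  = backward k≤l
  joins-sym (backward l≤k) = forward l≤k

  -- For `edge`, column l of r is that of the identity, so row λ_{kl} is zero outside K_{kl}. Row
  -- λ_{bi} of a `pair` vanishes on K_{kk} for k ≠ b, and on K_{bb} because r_{bi} = 0. Row λ_{ki}
  -- of a `loop` vanishes on every diagonal column other than K_{kk}. The row of `s` may meet all
  -- columns and therefore comes last.
  above-diagonal : ∀ {θ θ′ c c′} (F : Fits θ c) (F′ : Fits θ′ c′) → c ≢ c′ → rank F ℕ.≤ rank F′ →
    specialize (entry θ c′) ≈ 0ₚ
  above-diagonal {c′ = c′} (edge e v≡f kl) _ c≢c′ _ =
    trans (specialize-entryλ e pq) (entryλ-zero e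
      (λ k≡p → trans (r-false (v≡f _)) (reflexive (δ-≢ (joins-≢ kl pq c≢c′ k≡p))))
      (λ k≡q → trans (r-false (v≡f _)) (reflexive (δ-≢ (joins-≢ kl (joins-sym pq) c≢c′ k≡q)))))
    where
    pq = column-joins c′
  above-diagonal (pair _ _ _ _ _ ab) (pair _ _ _ _ _ ab′) c≢c′ _ =
    contradiction (joins-unique ab ab′) c≢c′
  above-diagonal (pair e vb _ _ _ _) (loop _ vk kk) _ _ =
    trans (specialize-entryλ e kk) (entryλ-off e (b≢k ∘ ≡.sym) (b≢k ∘ ≡.sym))
    where
    b≢k = v-≢ vk vb
  above-diagonal (pair e vb _ _ _ _) (base _ bb) _ _ =
    trans (specialize-entryλ e bb) (entryλ-zero e (λ _ → rbi≈0) (λ _ → rbi≈0))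
    where
    rbi≈0 : r b i ≈ 0ₚ
    rbi≈0 = trans (r-false vb) (reflexive (δ-≢ (⟶⇒≢ e)))
  above-diagonal (loop e _ kk) (loop e′ _ kk′) c≢c′ _ =
    trans (specialize-entryλ e kk′) (entryλ-off e k≢k′ k≢k′)
    where
    k≢k′ = λ { ≡.refl → c≢c′ (joins-unique kk kk′) }
  above-diagonal (loop e vk _) (base vb bb) _ _ =
    trans (specialize-entryλ e bb) (entryλ-off e (v-≢ vk (vb i)) (v-≢ vk (vb i)))
  above-diagonal (base _ bb) (base _ bb′) c≢c′ _ = contradiction (joins-unique bb bb′) c≢c′
  above-diagonal (pair _ _ _ _ _ _) (edge _ _ _) _ ()
  above-diagonal (loop _ _ _) (edge _ _ _) _ ()
  above-diagonal (loop _ _ _) (pair _ _ _ _ _ _) _ (s≤s ())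
  above-diagonal (base _ _) (edge _ _ _) _ ()
  above-diagonal (base _ _) (pair _ _ _ _ _ _) _ (s≤s ())
  above-diagonal (base _ _) (loop _ _ _) _ (s≤s (s≤s ()))

  cancellable-resp : ∀ {p q} → p ≈ q → Cancellable q → Cancellable p
  cancellable-resp p≈q cq x xp≈0 = cq x (trans (*-congˡ (sym p≈q)) xp≈0)

  cancellable-neg : ∀ {p} → Cancellable p → Cancellable (- p)
  cancellable-neg {p} cp x xp≈0 = cp x (begin
    x * p          ≈⟨ -‿involutive _ ⟨
    - (- (x * p))  ≈⟨ -‿cong (-‿distribʳ-* x p) ⟩
    - (x * - p)    ≈⟨ -‿cong xp≈0 ⟩
    - 0ₚ           ≈⟨ -0#≈0# ⟩
    0ₚ             ∎)
    where
    open RingProperties ring using (-‿involutive)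

  cancellable-1 : Cancellable 1ₚ
  cancellable-1 x x1≈0 = trans (sym (*-identityʳ x)) x1≈0

  -- K_{kk} is a sum of squares, so the `loop` entries carry a factor 2; characteristic other than
  -- two enters here, through the real number ½.
  cancellable-2 : Cancellable (1ₚ + 1ₚ)
  cancellable-2 x x2≈0 = begin
    x                            ≈⟨ *-identityʳ x ⟨
    x * 1ₚ                       ≈⟨ *-congˡ 2*½≈1 ⟨
    x * ((1ₚ + 1ₚ) * con (constᴿ ½))  ≈⟨ *-assoc _ _ _ ⟨
    x * (1ₚ + 1ₚ) * con (constᴿ ½)    ≈⟨ *-congʳ x2≈0 ⟩
    0ₚ * con (constᴿ ½)          ≈⟨ zeroˡ _ ⟩
    0ₚ                           ∎
    where
    module Rℝ = CommutativeRing ℝ-commutativeRing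
    2*½≈1 : (1ₚ + 1ₚ) * con (constᴿ ½) ≈ 1ₚ
    2*½≈1 = trans (*-congʳ (sym (con-⊕ Rℝ.1# Rℝ.1#)))
      (trans (sym (con-⊗ (Rℝ.1# Rℝ.+ Rℝ.1#) (constᴿ ½))) (con-cong (Rℝ.refl {Rℝ.1#})))

  diagonal : ∀ {θ c} → Fits θ c → Cancellable (specialize (entry θ c))
  diagonal (edge {k} {l} e v≡f kl) =
    cancellable-resp (trans (specialize-entryλ e kl) (-‿cong (begin
      δ k k * r l l + δ k l * r k l
        ≈⟨ +-cong (*-cong (reflexive (δ-refl k)) (trans (r-false (v≡f l)) (reflexive (δ-refl l))))
                  (*-congʳ (reflexive (δ-≢ (⟶⇒≢ e)))) ⟩
      1ₚ * 1ₚ + 0ₚ * r k l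
        ≈⟨ +-cong (*-identityˡ 1ₚ) (zeroˡ _) ⟩
      1ₚ + 0ₚ
        ≈⟨ +-identityʳ 1ₚ ⟩
      1ₚ ∎))) (cancellable-neg cancellable-1)
  diagonal (pair e vb e′ va _ ab) =
    cancellable-resp (trans (specialize-entryλ e ab) (-‿cong (begin
      δ b a * r b i + δ b b * r a i
        ≈⟨ +-cong (*-congʳ (reflexive (δ-≢ (v-≢ va vb ∘ ≡.sym))))
                  (*-cong (reflexive (δ-refl b)) (r-true e′ va)) ⟩
      0ₚ * r b i + 1ₚ * - 1ₚ
        ≈⟨ +-cong (zeroˡ _) (*-identityˡ _) ⟩
      0ₚ - 1ₚ
        ≈⟨ +-identityˡ _ ⟩
      - 1ₚ ∎))) (cancellable-neg (cancellable-neg cancellable-1))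
  diagonal (loop {k} e vk kk) =
    cancellable-resp (trans (specialize-entryλ e kk) (-‿cong (begin
      δ k k * r k i + δ k k * r k i
        ≈⟨ +-cong term term ⟩
      - 1ₚ - 1ₚ
        ≈⟨ -‿+-comm 1ₚ 1ₚ ⟩
      - (1ₚ + 1ₚ) ∎))) (cancellable-neg (cancellable-neg cancellable-2))
    where
    term : δ k k * r k i ≈ - 1ₚ
    term = trans (*-cong (reflexive (δ-refl k)) (r-true e vk)) (*-identityˡ _)
  diagonal (base vb (forward _)) = cancellable-resp norm cancellable-1
    where
    norm : specialize (∂ s (ψ b b)) ≈ 1ₚ
    norm = begin
      specialize (∂ s (ψ b b))
        ≈⟨ specialize-cong (∂s-ψ b b) ⟩
      specialize (sum (λ m → I-Λ b m * I-Λ b m))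
        ≈⟨ reflexive (specialize-sum (λ m → I-Λ b m * I-Λ b m)) ⟩
      sum (λ m → r b m * r b m)
        ≈⟨ sum-cong-≋ (λ m → *-cong (r-false (vb m)) (r-false (vb m))) ⟩
      sum (λ m → δ b m * δ b m)
        ≈⟨ sum-single (λ m → δ b m * δ b m) b (λ m m≢b →
             trans (*-congʳ (reflexive (δ-≢ (m≢b ∘ ≡.sym)))) (zeroˡ _)) ⟩
      δ b b * δ b b
        ≈⟨ *-cong (reflexive (δ-refl b)) (reflexive (δ-refl b)) ⟩
      1ₚ * 1ₚ
        ≈⟨ *-identityˡ 1ₚ ⟩
      1ₚ ∎
  diagonal (base vb (backward p)) = diagonal (base vb (forward p))

  fits⇒independent : ∀ {S} → Unique S → (∀ k → ∃ λ θ → Fits θ (lookup S k)) → Independent G S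
  fits⇒independent {S} unique fits = kernel-trivial⇒independent {S}
    (specialize-injective _ (triangular-injective _ (proj₁ ∘ fits) (λ k → rank (proj₂ (fits k)))
      (λ k → diagonal (proj₂ (fits k)))
      (λ {j} {k} j≢k → above-diagonal (proj₂ (fits j)) (proj₂ (fits k))
        (j≢k ∘ lookup-injective unique))))

  module _ (simple : Simple G) where
    private
      not-diagonal : ∀ {k l m} {c : Column n} {A : Set} → k ⟶ l → Joins k l c → Joins m m c → A
      not-diagonal e kl mm = contradiction (joins-diagonal kl mm) (⟶⇒≢ e)
      -- The claim is symmetric, so only pairs of kinds in increasing rank are examined. Simplicity
      -- excludes opposite edges, nonadjacency separates `pair` from `edge`, and the vanishing of
      -- `v b` separates `loop` from `base`.
      ordered : ∀ {θ θ′ c} (F : Fits θ c) (F′ : Fits θ′ c) → rank F ℕ.≤ rank F′ → θ ≡ θ′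
      ordered (edge {k} {l} e _ kl) (edge e′ _ kl′) _ with joins-endpoints kl kl′
      ... | inj₁ (≡.refl , ≡.refl) = ≡.cong λ[_] (Bool.T-irrelevant e e′)
      ... | inj₂ (≡.refl , ≡.refl) = contradiction (e , e′) (simple k l)
      ordered (edge e _ kl) (pair _ _ _ _ ¬adj ab) _ with joins-endpoints kl ab
      ... | inj₁ (≡.refl , ≡.refl) = contradiction (inj₁ e) ¬adj
      ... | inj₂ (≡.refl , ≡.refl) = contradiction (inj₂ e) ¬adj
      ordered (edge e _ kl) (loop _ _ mm) _ = not-diagonal e kl mm
      ordered (edge e _ kl) (base _ mm)   _ = not-diagonal e kl mm
      ordered (pair e _ _ _ _ _) (pair e′ _ _ _ _ _) _ = ≡.cong λ[_] (Bool.T-irrelevant e e′)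
      ordered (pair _ vb _ va _ ab) (loop _ _ mm) _ = contradiction (joins-diagonal ab mm) (v-≢ va vb)
      ordered (pair _ vb _ va _ ab) (base _ mm)   _ = contradiction (joins-diagonal ab mm) (v-≢ va vb)
      ordered (loop e _ kk) (loop e′ _ kk′) _ with joins-endpoints kk kk′
      ... | inj₁ (≡.refl , _) = ≡.cong λ[_] (Bool.T-irrelevant e e′)
      ... | inj₂ (≡.refl , _) = ≡.cong λ[_] (Bool.T-irrelevant e e′)
      ordered (loop _ vk kk) (base vb bb) _ with joins-endpoints kk bb
      ... | inj₁ (≡.refl , _) = contradiction ≡.refl (v-≢ vk (vb i))
      ... | inj₂ (≡.refl , _) = contradiction ≡.refl (v-≢ vk (vb i))
      ordered (base _ _) (base _ _) _ = ≡.refl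
      ordered (pair _ _ _ _ _ _) (edge _ _ _) ()
      ordered (loop _ _ _) (edge _ _ _) ()
      ordered (loop _ _ _) (pair _ _ _ _ _ _) (s≤s ())
      ordered (base _ _) (edge _ _ _) ()
      ordered (base _ _) (pair _ _ _ _ _ _) (s≤s ())
      ordered (base _ _) (loop _ _ _) (s≤s (s≤s ()))

    -- Ensures that the matched columns form a list without repetition, as long as the list of
    -- parameters.
    fits-injective : ∀ {θ θ′ c} → Fits θ c → Fits θ′ c → θ ≡ θ′
    fits-injective F F′ with ℕ.≤-total (rank F) (rank F′)
    ... | inj₁ F≤F′ = ordered F F′ F≤F′
    ... | inj₂ F′≤F = ≡.sym (ordered F′ F F′≤F)

-- Rank comparison

open CommutativeMonoidSum ℕ.+-0-commutativeMonoid using ()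
  renaming (sum to ∑; sum-remove to ∑-remove; sum-cong-≗ to ∑-cong)

trues : ∀ {n} (f : Fin n → Bool) → List (∃ (T ∘ f))
trues {zero}  f = []
trues {suc n} f with T? (f zero)
... | yes t = (zero , t) ∷ map (λ (k , t) → suc k , t) (trues (f ∘ suc))
... | no  _ = map (λ (k , t) → suc k , t) (trues (f ∘ suc))

length-trues : ∀ {n} (f : Fin n → Bool) → length (trues f) ≡ ∣ Vec.tabulate f ∣
length-trues {zero}  f = ≡.refl
-- The size of a subset counts by comparison with `true`, `trues` by deciding `T`; both tests are
-- split and the mixed outcomes refuted.
length-trues {suc n} f with T? (f zero) | f zero Bool.≟ true
... | yes _ | yes _  = ≡.cong suc (≡.trans (length-map _ (trues (f ∘ suc))) (length-trues (f ∘ suc)))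
... | no  _ | no _   = ≡.trans (length-map _ (trues (f ∘ suc))) (length-trues (f ∘ suc))
... | yes t | no f≢t = contradiction (Equivalence.to Bool.T-≡ t) f≢t
... | no ¬t | yes f≡t = contradiction (Equivalence.from Bool.T-≡ f≡t) ¬t

∈-trues : ∀ {n} (f : Fin n → Bool) k (t : T (f k)) → (k , t) ∈ trues f
∈-trues {suc n} f zero t with T? (f zero)
... | yes t′ = here (≡.cong (zero ,_) (Bool.T-irrelevant t t′))
... | no ¬t  = contradiction t ¬t
∈-trues {suc n} f (suc k) t with T? (f zero)
... | yes _ = there (∈-map⁺ _ (∈-trues (f ∘ suc) k t))
... | no  _ = ∈-map⁺ _ (∈-trues (f ∘ suc) k t)

trues-unique : ∀ {n} (f : Fin n → Bool) → Unique (trues f)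
trues-unique {zero}  f = []
trues-unique {suc n} f with T? (f zero)
... | yes _ = All.map⁺ (All.universal (λ _ ()) _) ∷ Unique.map⁺ (λ { ≡.refl → ≡.refl }) (trues-unique (f ∘ suc))
... | no  _ = Unique.map⁺ (λ { ≡.refl → ≡.refl }) (trues-unique (f ∘ suc))

length-concat-tabulate : ∀ {a} {A : Set a} {m} (f : Fin m → List A) →
  length (concat (tabulate f)) ≡ ∑ (length ∘ f)
length-concat-tabulate {m = zero}  f = ≡.refl
length-concat-tabulate {m = suc m} f =
  ≡.trans (length-++ (f zero)) (≡.cong (length (f zero) ℕ.+_) (length-concat-tabulate (f ∘ suc)))

outdegree : ∀ {n} → Digraph n → Fin n → ℕ
outdegree G k = ∣ ch G k ∣

module Rows {n} (G : Digraph n) where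
  open Jacobian G using (Parameter; λ[_]; s; _⟶_; D)

  edgesFrom : Fin n → List Parameter
  edgesFrom k = map (λ (_ , e) → λ[ e ]) (trues (D k))

  -- With `id` these are all parameters; with `punchIn i` they are `s` and the edges whose source is
  -- not `i`.
  rows : ∀ {m} → (Fin m → Fin n) → List Parameter
  rows f = s ∷ concat (tabulate (edgesFrom ∘ f))

  length-rows : ∀ {m} (f : Fin m → Fin n) → length (rows f) ≡ suc (∑ (outdegree G ∘ f))
  length-rows f = ≡.cong suc (≡.trans (length-concat-tabulate (edgesFrom ∘ f))
    (∑-cong λ j → ≡.trans (length-map _ (trues (D (f j)))) (length-trues (D (f j)))))

  source-unique : ∀ {k l k′ l′} {e : k ⟶ l} {e′ : k′ ⟶ l′} → λ[ e ] ≡ λ[ e′ ] → k ≡ k′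
  source-unique ≡.refl = ≡.refl

  ∈-edgesFrom⁻ : ∀ {θ k} → θ ∈ edgesFrom k → ∃ λ l → ∃ λ (e : k ⟶ l) → θ ≡ λ[ e ]
  ∈-edgesFrom⁻ θ∈ = let (l , e) , _ , eq = ∈-map⁻ _ θ∈ in l , e , eq

  ∈-rows⁺ : ∀ {m} (f : Fin m → Fin n) j {l} (e : f j ⟶ l) → λ[ e ] ∈ rows f
  ∈-rows⁺ f j {l} e =
    there (∈-concat⁺′ (∈-map⁺ _ (∈-trues (D (f j)) l e)) (∈-tabulate⁺ {f = edgesFrom ∘ f} j))

  ∈-rows⁻ : ∀ {m} (f : Fin m → Fin n) {k l} {e : k ⟶ l} → λ[ e ] ∈ rows f → ∃ λ j → k ≡ f j
  ∈-rows⁻ f (there θ∈) =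
    let _ , θ∈edges , edges∈ = ∈-concat⁻′ (tabulate (edgesFrom ∘ f)) θ∈
        j , eq               = ∈-tabulate⁻ edges∈
        _ , _ , θ≡           = ∈-edgesFrom⁻ (≡.subst (_ ∈_) eq θ∈edges)
    in j , source-unique θ≡

  s∉edgesFrom : ∀ k → All (s ≢_) (edgesFrom k)
  s∉edgesFrom k = All.map⁺ (All.universal (λ _ ()) (trues (D k)))

  rows-unique : ∀ {m} (f : Fin m → Fin n) → (∀ {j k} → f j ≡ f k → j ≡ k) → Unique (rows f)
  rows-unique f f-injective =
    All.concat⁺ (All.tabulate⁺ {f = edgesFrom ∘ f} (s∉edgesFrom ∘ f)) ∷
    Unique.concat⁺
      (All.tabulate⁺ {f = edgesFrom ∘ f} λ j → Unique.map⁺ (λ { ≡.refl → ≡.refl }) (trues-unique (D (f j))))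
      (AllPairs.tabulate⁺ λ j≢k (θ∈j , θ∈k) →
        let _ , _ , eq  = ∈-edgesFrom⁻ θ∈j
            _ , _ , eq′ = ∈-edgesFrom⁻ θ∈k
        in j≢k (f-injective (source-unique (≡.trans (≡.sym eq) eq′))))

Avoids : ∀ {n} → Fin n → Column n → Set
Avoids k c = Column.row c ≢ k × Column.col c ≢ k

joins-avoids : ∀ {n} {k p q : Fin n} {c} → Joins p q c → p ≢ k → q ≢ k → Avoids k c
joins-avoids (forward _)  p≢k q≢k = p≢k , q≢k
joins-avoids (backward _) p≢k q≢k = q≢k , p≢k

module Columns {n} (G : Digraph n) (simple : Simple G) (v : Fin n → Fin n → Bool) (i a b : Fin n)
  (choose : ∀ θ → ∃ (Matching.Fits G v i a b θ))
  where
  open Matching G v i a b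
  open Rows G

  columns : ∀ {m} → (Fin m → Fin n) → List (Column n)
  columns f = map (proj₁ ∘ choose) (rows f)

  ∈-columns⁻ : ∀ {m} (f : Fin m → Fin n) {c} → c ∈ columns f →
    ∃ λ θ → θ ∈ rows f × c ≡ proj₁ (choose θ)
  ∈-columns⁻ f = ∈-map⁻ (proj₁ ∘ choose)

  columns-unique : ∀ {m} (f : Fin m → Fin n) → (∀ {j k} → f j ≡ f k → j ≡ k) → Unique (columns f)
  columns-unique f f-injective = Unique.map⁺
    (λ {θ} {θ′} eq → fits-injective simple (proj₂ (choose θ))
      (≡.subst (Fits θ′) (≡.sym eq) (proj₂ (choose θ′))))
    (rows-unique f f-injective)

  columns-independent : ∀ {m} (f : Fin m → Fin n) → (∀ {j k} → f j ≡ f k → j ≡ k) →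
    Independent G (columns f)
  columns-independent f f-injective = fits⇒independent (columns-unique f f-injective) λ k →
    let θ , _ , eq = ∈-columns⁻ f (∈-lookup k)
    in θ , ≡.subst (Fits θ) (≡.sym eq) (proj₂ (choose θ))

  length-columns : ∀ {m} (f : Fin m → Fin n) → length (columns f) ≡ suc (∑ (outdegree G ∘ f))
  length-columns f = ≡.trans (length-map _ (rows f)) (length-rows f)

-- An edge whose source is avoided by every column of `S` has a zero row on `S`, so only the edges
-- counted by the sum, together with `s`, contribute to the rank.
independent⇒length≤∑ : ∀ {m n} (G : Digraph n) (S : List (Column n)) → Independent G S →
  (f : Fin m → Fin n) → (∀ k → (∃ λ j → f j ≡ k) ⊎ (∀ {c} → c ∈ S → Avoids k c)) →
  length S ℕ.≤ suc (∑ (outdegree G ∘ f))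
independent⇒length≤∑ G S indep f cover =
  ≡.subst (length S ℕ.≤_) (length-rows f) (independent⇒length≤ {S} indep (rows f) covered)
  where
  open Jacobian G
  open Rows G
  covered : ∀ θ → θ ∈ rows f ⊎ (∀ k → entry θ (lookup S k) ≈ 0ₚ)
  covered s = inj₁ (here ≡.refl)
  covered (λ[_] {k} e) with cover k
  ... | inj₁ (j , ≡.refl) = inj₁ (∈-rows⁺ f j e)
  ... | inj₂ avoids = inj₂ λ x →
    let row≢ , col≢ = avoids (∈-lookup x) in entry-zero e (lookup S x) row≢ col≢

SameJacobianMatroid-sym : ∀ {n} {G₁ G₂ : Digraph n} → SameJacobianMatroid G₁ G₂ → SameJacobianMatroid G₂ G₁
SameJacobianMatroid-sym same S unique =
  mk⇔ (Equivalence.from (same S unique)) (Equivalence.to (same S unique))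

-- At Λ = 0 the matrix I - Λ is the identity, so each edge keeps its own column K_{kl}, and K_{ii}
-- serves `s`. The list attains the bound |D| + 1.
module Full {n} (G : Digraph n) (simple : Simple G) (i : Fin n) where
  open Jacobian G using (λ[_]; s; _⟶_)
  open Matching G (λ _ _ → false) i i i

  choose : ∀ θ → ∃ (Fits θ)
  choose (λ[_] {k} {l} e) = pairColumn k l , edge e (λ _ → ≡.refl) (joins-pairColumn k l)
  choose s                = pairColumn i i , base (λ _ → ≡.refl) (joins-pairColumn i i)

  open Columns G simple (λ _ _ → false) i i i choose public

  columns-adjacent : ∀ {m} (f : Fin m → Fin n) {c} → c ∈ columns f →
    (∃₂ λ k l → k ⟶ l × Joins k l c) ⊎ Joins i i c
  columns-adjacent f c∈ with ∈-columns⁻ f c∈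
  ... | λ[_] {k} {l} e , _ , ≡.refl = inj₁ (k , l , e , joins-pairColumn k l)
  ... | s , _ , ≡.refl              = inj₂ (joins-pairColumn i i)

-- The diagonal columns K_{kk} serve the parameters λ_{ki}, except that K_{bb} is
-- reserved for s.  If b is a parent of i, then λ_{bi} gets the column K_{ab}, which
-- is free because a and b are not adjacent.

record Gap {n} (G : Digraph n) (i : Fin n) : Set where
  open Digraph G
  field
    a b : Fin n
    b≢i : b ≢ i
    gap : ¬ b ⟶ i ⊎ (a ⟶ i × a ≢ b × ¬ Adjacent a b)

module Away {n} (G : Digraph n) (simple : Simple G) (i : Fin n) (g : Gap G i) where
  open Gap g
  open Jacobian G using (Parameter; λ[_]; s; _⟶_)

  -- Ones in column i of Λ make the diagonal entries for λ_{ki} nonzero; row b stays zero so that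
  -- K_{bb} can serve `s`.
  v : Fin n → Fin n → Bool
  v k l = does (l Fin.≟ i) ∧ not (does (k Fin.≟ b))

  v-b : ∀ m → v b m ≡ false
  v-b m rewrite dec-true (b Fin.≟ b) ≡.refl = Bool.∧-zeroʳ _

  v-≢i : ∀ {l} → l ≢ i → ∀ k → v k l ≡ false
  v-≢i {l} l≢i k rewrite dec-false (l Fin.≟ i) l≢i = ≡.refl

  v-i : ∀ {k} → k ≢ b → v k i ≡ true
  v-i {k} k≢b rewrite dec-true (i Fin.≟ i) ≡.refl | dec-false (k Fin.≟ b) k≢b = ≡.refl

  open Matching G v i a b hiding (point)

  SourceNot : Fin n → Parameter → Set
  SourceNot j θ = ∀ {k l} {e : k ⟶ l} → θ ≡ λ[ e ] → k ≢ j

  -- An edge that does not point to `i` keeps its own column, which meets `i` only if its source is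
  -- `i`; hence the condition on the source. An edge into `i` must move, since its own column
  -- contains `i`.
  choose-avoiding : ∀ θ → ∃ λ c → Fits θ c × (SourceNot i θ → Avoids i c)
  choose-avoiding s =
    pairColumn b b , base v-b bb , λ _ → joins-avoids bb b≢i b≢i
    where
    bb = joins-pairColumn b b
  choose-avoiding (λ[_] {k} {l} e) with l Fin.≟ i
  ... | no l≢i = pairColumn k l , edge e (v-≢i l≢i) kl , λ k≢i → joins-avoids kl (k≢i ≡.refl) l≢i
    where
    kl = joins-pairColumn k l
  ... | yes ≡.refl with k Fin.≟ b
  ...   | no k≢b = pairColumn k k , loop e (v-i k≢b) kk , λ k≢i → joins-avoids kk (k≢i ≡.refl) (k≢i ≡.refl)
    where
    kk = joins-pairColumn k k
  ...   | yes ≡.refl with gap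
  ...     | inj₁ ¬e = contradiction e ¬e
  ...     | inj₂ (e′ , a≢b , ¬adj) =
    pairColumn a b , pair e (v-b i) e′ (v-i a≢b) ¬adj ab , λ _ → joins-avoids ab (⟶⇒≢ e′) b≢i
    where
    ab = joins-pairColumn a b

  open Columns G simple v i a b (λ θ → proj₁ (choose-avoiding θ) , proj₁ (proj₂ (choose-avoiding θ))) public

  columns-avoid : ∀ {m} (f : Fin m → Fin n) → (∀ j → f j ≢ i) → ∀ {c} → c ∈ columns f → Avoids i c
  columns-avoid f f≢i c∈ with ∈-columns⁻ f c∈
  ... | θ , θ∈ , ≡.refl = proj₂ (proj₂ (choose-avoiding θ)) λ where
    ≡.refl ≡.refl → let j , eq = Rows.∈-rows⁻ G f θ∈ in f≢i j (≡.sym eq)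

-- Two graphs with the same matroid

module _ {n} {G₁ G₂ : Digraph n} (simple : Simple G₁) (same : SameJacobianMatroid G₁ G₂) where

  ∑-outdegree-≤ : Fin n → ∑ (outdegree G₁) ℕ.≤ ∑ (outdegree G₂)
  ∑-outdegree-≤ i = ℕ.s≤s⁻¹ (≡.subst (ℕ._≤ suc (∑ (outdegree G₂))) (length-columns id)
    (independent⇒length≤∑ G₂ (columns id)
      (Equivalence.to (same (columns id) (columns-unique id id)) (columns-independent id id))
      id (λ k → inj₁ (k , ≡.refl))))
    where
    open Full G₁ simple i

  ¬gap-complete : Fin n → Complete G₁ → ∀ {a b} → a ≢ b → ¬ Digraph.Adjacent G₂ a b → ¬ Simple G₂
  ¬gap-complete i complete {a} {b} a≢b ¬adj simple₂ = ℕ.<-irrefl ≡.refl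
    (≡.subst (λ k → suc k ℕ.≤ suc (∑ (outdegree G₂))) (length-columns id)
      (independent⇒length≤∑ G₂ S (Equivalence.to (same S unique) independent)
        id (λ k → inj₁ (k , ≡.refl))))
    where
    open Full G₂ simple₂ i
    open Matching G₁ (λ _ _ → false) i i i

    -- One column more than the bound |D₂| + 1 for independent sets of `G₂`.
    S : List (Column n)
    S = pairColumn a b ∷ columns id

    ab∉columns : pairColumn a b ∉ columns id
    ab∉columns ab∈ with columns-adjacent id ab∈
    ... | inj₂ ii = a≢b (joins-diagonal (joins-pairColumn a b) ii)
    ... | inj₁ (k , l , e , kl) with joins-endpoints (joins-pairColumn a b) kl
    ...   | inj₁ (≡.refl , ≡.refl) = ¬adj (inj₁ e)
    ...   | inj₂ (≡.refl , ≡.refl) = ¬adj (inj₂ e)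

    unique : Unique S
    unique = All.tabulate (λ c∈ → λ { ≡.refl → ab∉columns c∈ }) ∷ columns-unique id id

    -- By completeness every off-diagonal column belongs to an edge of `G₁`, possibly with the
    -- opposite orientation, and at Λ = 0 all such columns fit together with K_{ii}.
    fits-pair : ∀ {k l} → k ≢ l → ∀ {c} → Joins k l c → ∃ λ θ → Fits θ c
    fits-pair {k} {l} k≢l kl with complete k l k≢l
    ... | inj₁ e = _ , edge e (λ _ → ≡.refl) kl
    ... | inj₂ e = _ , edge e (λ _ → ≡.refl) (joins-sym kl)

    fits : ∀ {c} → c ∈ S → ∃ λ θ → Fits θ c
    fits (here ≡.refl) = fits-pair a≢b (joins-pairColumn a b)
    fits (there c∈) with columns-adjacent id c∈
    ... | inj₂ ii               = _ , base (λ _ → ≡.refl) ii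
    ... | inj₁ (k , l , e , kl) = fits-pair (λ { ≡.refl → Digraph.loopless G₂ k e }) kl

    independent : Independent G₁ S
    independent = fits⇒independent unique λ k → fits (∈-lookup k)

-- Avoiding `i` is a property of the columns alone. A list built from `G₁` thus also kills the rows
-- of `G₂` with source `i`, and its length is bounded by the remaining rows of `G₂`.
∑-away-≤ : ∀ {n} {G₁ G₂ : Digraph (suc n)} → Simple G₁ → SameJacobianMatroid G₁ G₂ →
  ∀ i → Gap G₁ i → ∑ (outdegree G₁ ∘ punchIn i) ℕ.≤ ∑ (outdegree G₂ ∘ punchIn i)
∑-away-≤ {n} {G₁} {G₂} simple same i g =
  ℕ.s≤s⁻¹ (≡.subst (ℕ._≤ suc (∑ (outdegree G₂ ∘ punchIn i))) (length-columns (punchIn i))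
    (independent⇒length≤∑ G₂ (columns (punchIn i))
      (Equivalence.to (same (columns (punchIn i)) (columns-unique (punchIn i) injective))
                      (columns-independent (punchIn i) injective))
      (punchIn i) cover))
  where
  open Away G₁ simple i g
  injective : ∀ {j k} → punchIn i j ≡ punchIn i k → j ≡ k
  injective = Fin.punchIn-injective i _ _
  cover : ∀ k → (∃ λ j → punchIn i j ≡ k) ⊎ (∀ {c} → c ∈ columns (punchIn i) → Avoids k c)
  cover k with i Fin.≟ k
  ... | no i≢k     = inj₁ (punchOut i≢k , Fin.punchIn-punchOut i≢k)
  ... | yes ≡.refl = inj₂ (columns-avoid (punchIn i) (Fin.punchInᵢ≢i i))

adjacent? : ∀ {n} (G : Digraph n) a b → Dec (Digraph.Adjacent G a b)
adjacent? G a b = T? (Digraph.D G a b) ⊎-dec T? (Digraph.D G b a)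

-- A finite search: it turns the negated completeness hypothesis into an explicit nonadjacent pair.
complete⊎gap : ∀ {n} (G : Digraph n) →
  Complete G ⊎ (∃₂ λ a b → a ≢ b × ¬ Digraph.Adjacent G a b)
complete⊎gap {n} G with Fin.any? (λ a → Fin.any? (λ b → ¬? (a Fin.≟ b) ×-dec ¬? (adjacent? G a b)))
... | yes (a , b , a≢b , ¬adj) = inj₂ (a , b , a≢b , ¬adj)
... | no none = inj₁ λ a b a≢b →
  decidable-stable (adjacent? G a b) λ ¬adj → none (a , b , a≢b , ¬adj)

-- If one of the two nodes is `i`, the other is not a parent of `i` and becomes `b`. Otherwise
-- either one of them is not a parent of `i`, and is taken as `b`, or both are, and the pair itself
-- is the gap.
nonadjacent⇒Gap : ∀ {n} (G : Digraph n) i {a b} → a ≢ b → ¬ Digraph.Adjacent G a b → Gap G i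
nonadjacent⇒Gap G i {a} {b} a≢b ¬adj with b Fin.≟ i | a Fin.≟ i | T? (Digraph.D G a i)
... | yes ≡.refl | _          | _     = record { a = b ; b = a ; b≢i = a≢b ; gap = inj₁ (¬adj ∘ inj₁) }
... | no b≢i     | yes ≡.refl | _     = record { a = a ; b = b ; b≢i = b≢i ; gap = inj₁ (¬adj ∘ inj₂) }
... | no b≢i     | no a≢i     | no ¬e = record { a = b ; b = a ; b≢i = a≢i ; gap = inj₁ ¬e }
... | no b≢i     | no _       | yes e = record { a = a ; b = b ; b≢i = b≢i ; gap = inj₂ (e , a≢b , ¬adj) }

theorem4p5 : ∀ (n : ℕ) (G₁ G₂ : Digraph n) → Simple G₁ → Simple G₂ →
    (¬ Complete G₁ ⊎ ¬ Complete G₂) →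
    (∃ λ (i : Fin n) → ∣ ch G₁ i ∣ ≢ ∣ ch G₂ i ∣) →
    ¬ SameJacobianMatroid G₁ G₂
-- The node `i` rules out the empty node set, and `punchIn i` enumerates the other nodes.
theorem4p5 (suc n) G₁ G₂ simple₁ simple₂ incomplete (i , ch≢) same
  with complete⊎gap G₁ | complete⊎gap G₂
... | inj₁ c₁ | inj₁ c₂ = case incomplete of λ where
  (inj₁ ¬c₁) → ¬c₁ c₁
  (inj₂ ¬c₂) → ¬c₂ c₂
... | inj₁ c₁ | inj₂ (_ , _ , a≢b , ¬adj) = ¬gap-complete simple₁ same i c₁ a≢b ¬adj simple₂
... | inj₂ (_ , _ , a≢b , ¬adj) | inj₁ c₂ =
  ¬gap-complete simple₂ (SameJacobianMatroid-sym {G₁ = G₁} {G₂} same) i c₂ a≢b ¬adj simple₁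
... | inj₂ (_ , _ , a≢b₁ , ¬adj₁) | inj₂ (_ , _ , a≢b₂ , ¬adj₂) = ch≢
  (ℕ.+-cancelʳ-≡ _ _ _ (begin
    outdegree G₁ i ℕ.+ ∑ (outdegree G₁ ∘ punchIn i)  ≡⟨ ∑-remove (outdegree G₁) ⟨
    ∑ (outdegree G₁)                                 ≡⟨ ℕ.≤-antisym (∑-outdegree-≤ simple₁ same i) (∑-outdegree-≤ simple₂ same′ i) ⟩
    ∑ (outdegree G₂)                                 ≡⟨ ∑-remove (outdegree G₂) ⟩
    outdegree G₂ i ℕ.+ ∑ (outdegree G₂ ∘ punchIn i)  ≡⟨ ≡.cong (outdegree G₂ i ℕ.+_) away ⟨
    outdegree G₂ i ℕ.+ ∑ (outdegree G₁ ∘ punchIn i)  ∎))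
  where
  open ≡.≡-Reasoning
  same′ : SameJacobianMatroid G₂ G₁
  same′ = SameJacobianMatroid-sym {G₁ = G₁} {G₂} same
  away : ∑ (outdegree G₁ ∘ punchIn i) ≡ ∑ (outdegree G₂ ∘ punchIn i)
  away = ℕ.≤-antisym (∑-away-≤ simple₁ same i (nonadjacent⇒Gap G₁ i a≢b₁ ¬adj₁))
                     (∑-away-≤ simple₂ same′ i (nonadjacent⇒Gap G₂ i a≢b₂ ¬adj₂))
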